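{- Let $\alpha>0$ and let $D$ be an Eulerian multi-digraph on $n$ vertices whose underlying simple graph, obtained from $D$ by ignoring directions and multiplicities, has minimum degree at least $\alpha n$. Then $D$ immerses $\overrightarrow{K}_s$, where $s = 10^{ -9}\alpha^4 n$ (rounded down to an integer).
   Context: Multi-digraphs have no loops but may contain several copies of an edge; degrees are counted with multiplicity. A multi-digraph is Eulerian if at every vertex the in-degree equals the out-degree. $\overrightarrow{K}_s$ is the complete digraph on $s$ vertices, with edges in both directions between every two vertices. A multi-digraph $G$ immerses $H$ if there is an injective $f:V(H)\to V(G)$ and pairwise edge-disjoint directed paths $P_e$ in $G$, one per edge $e=uv$ of $H$, from $f(u)$ to $f(v)$.
   Formalization: The parameter α is taken to be a positive rational number instead of a positive real; the real case follows by replacing α with (minimum degree)/n. -}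

module Defs where

open import Data.Nat using (ℕ; zero; suc; _+_; _≤_; _<_)
open import Data.Fin using (Fin)
open import Data.List using (List; []; _∷_; map; length; filter; concat)
open import Data.Nat.ListAction using (sum)
open import Data.List.Base using (allFin)
open import Data.List.Relation.Unary.Unique.Propositional using (Unique)
open import Data.List.Relation.Unary.Linked using (Linked)
open import Data.List.Relation.Unary.All using (All)
open import Data.Product using (Σ; _×_; _,_; proj₁)
open import Data.Maybe using (Maybe; just; nothing)
open import Relation.Binary.PropositionalEquality using (_≡_; _≢_)
open import Relation.Nullary using (¬_)
open import Relation.Nullary.Decidable using (Dec; yes; no)
open import Data.Fin.Properties using (_≟_)
open import Function.Definitions using (Injective)
import Data.Nat.Properties as ℕₚ

-- Loopless multi-digraphs on vertex set Fin n, given by edge multiplicities: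
-- mult u v = number of copies of the directed edge u → v.

record MultiDigraph (n : ℕ) : Set where
  field
    mult     : Fin n → Fin n → ℕ
    loopless : ∀ v → mult v v ≡ 0
open MultiDigraph public

Σᵥ : ∀ {n} → (Fin n → ℕ) → ℕ
Σᵥ {n} f = sum (map f (allFin n))

outdeg : ∀ {n} → MultiDigraph n → Fin n → ℕ
outdeg D v = Σᵥ (λ u → mult D v u)

indeg : ∀ {n} → MultiDigraph n → Fin n → ℕ
indeg D v = Σᵥ (λ u → mult D u v)

Eulerian : ∀ {n} → MultiDigraph n → Set
Eulerian D = ∀ v → indeg D v ≡ outdeg D v

Adj : ∀ {n} → MultiDigraph n → Fin n → Fin n → Set
Adj D u v = (u ≢ v) × (0 < mult D u v + mult D v u)

adj? : ∀ {n} (D : MultiDigraph n) u v → Dec (Adj D u v)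
adj? D u v with u ≟ v | 0 Data.Nat.<? (mult D u v + mult D v u)
... | yes p | _     = no (λ a → proj₁ a p)
... | no p  | yes q = yes (p , q)
... | no p  | no q  = no (λ a → q (Data.Product.proj₂ a))

simpleDeg : ∀ {n} → MultiDigraph n → Fin n → ℕ
simpleDeg {n} D v = length (filter (adj? D v) (allFin n))

edgesOf : ∀ {n} → List (Fin n) → List (Fin n × Fin n)
edgesOf []           = []
edgesOf (x ∷ [])     = []
edgesOf (x ∷ y ∷ xs) = (x , y) ∷ edgesOf (y ∷ xs)

head? : ∀ {n} → List (Fin n) → Maybe (Fin n)
head? []      = nothing
head? (x ∷ _) = just x

last? : ∀ {n} → List (Fin n) → Maybe (Fin n)
last? []           = nothing
last? (x ∷ [])     = just x
last? (x ∷ y ∷ xs) = last? (y ∷ xs)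

IsPath : ∀ {n} → MultiDigraph n → Fin n → Fin n → List (Fin n) → Set
IsPath D a b p =
  (head? p ≡ just a) × (last? p ≡ just b) × Unique p ×
  All (λ e → 0 < mult D (Data.Product.proj₁ e) (Data.Product.proj₂ e)) (edgesOf p)

count : ∀ {n} → Fin n → Fin n → List (Fin n × Fin n) → ℕ
count u v [] = 0
count u v ((x , y) ∷ es) with x ≟ u | y ≟ v
... | yes _ | yes _ = suc (count u v es)
... | _     | _     = count u v es

Kedge : ℕ → Set
Kedge s = Σ (Fin s × Fin s) (λ e → Data.Product.proj₁ e ≢ Data.Product.proj₂ e)

kedges : (s : ℕ) → List (Kedge s)
kedges s = concat (map (λ i → go i (allFin s)) (allFin s))
  where
  go : Fin s → List (Fin s) → List (Kedge s)
  go i []       = []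
  go i (j ∷ js) with i ≟ j
  ... | yes _ = go i js
  ... | no ij = ((i , j) , ij) ∷ go i js

-- D immerses K⃗_s: an injective f : Fin s → Fin n and, for each edge ij of
-- K⃗_s, a directed path P ij from f i to f j in D, pairwise edge-disjoint,
-- i.e. every directed edge u → v of D is used (in total, over all paths) at
-- most mult D u v times (paths using distinct parallel copies).
ImmersesK : ∀ {n} → MultiDigraph n → ℕ → Set
ImmersesK {n} D s =
  Σ (Fin s → Fin n) λ f → Injective _≡_ _≡_ f ×
  Σ (Kedge s → List (Fin n)) λ P →
    (∀ (e : Kedge s) → IsPath D (f (proj₁ (proj₁ e))) (f (Data.Product.proj₂ (proj₁ e))) (P e)) ×
    (∀ u v → count u v (concat (map (λ e → edgesOf (P e)) (kedges s))) ≤ mult D u v)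

{-# OPTIONS --safe #-}

-- Write α = p/d and let A be a minimal nonempty set of vertices whose edge
-- boundary in the underlying graph has density at most α/2.  By minimality
-- every cut of A has density at least α/2, and A contains at least α|A|n/2
-- ordered adjacent pairs.
--
-- Split A into blocks of 2s vertices and greedily remove from D edge-disjoint
-- paths joining pairs inside a block, where only the last remaining copy of an
-- edge inside A costs 1, all other edges are free, and paths of cost T or more
-- are not used.  Let f be the resulting distance in the residual digraph,
-- truncated at T.  For φ = f (u , -), the sum of φ y - φ x over the edges
-- x → y vanishes up to the few removed paths because D is Eulerian, and φ
-- ascends only along charged edges; hence the total variation of φ over all edges
-- is O(|A|²), and since the cuts of A are dense, φ is almost constant on A up
-- to O(1/α).  The same holds for f (- , v).  As f ≤ 1 on the many adjacent pairs,
-- the average of f on A × A is O(|A|/(α²n)), well below T.  So some block has s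
-- vertices with small average distance to and from A; any two of them are at
-- distance below T, hence have been joined by a path.
module Submission where

open import Data.Nat.Tactic.RingSolver using (solve-∀)
open import Relation.Binary.PropositionalEquality

open import Defs

-- The obstacle is that multiplicities are unbounded, so neither edge numbers nor path lengths are
-- controlled by n. The number of ordered pairs inside A is controlled; this is why an edge is
-- charged only when its removal destroys the last copy. The set A is needed because D itself may
-- have sparse cuts, across which distances differ widely. Each link shifts the Eulerian balance by
-- at most T and exhausts at most T pairs of A, each of which carries a variation of at most T. So N
-- links cause a total error of N T + N T², which must stay below |A|². Demands inside blocks of 2s
-- vertices give N ≤ 2s|A|, and the condition becomes s T² = O(|A|). The average distance forces T
-- to be of order |A|/(α²n), so s may be of order α⁴n²/|A|, which is at least α⁴n: the origin of the
-- fourth power. The constants: the average distance is at most 194|A|/(α²n), the choice of a block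
-- costs a factor 16, so T is about 3104|A|/(α²n), at most 3106|A|/(α²n) after rounding, and 16 *
-- 3106² is below 10⁹.

module Immersions where

  open import Data.Bool.Base using (Bool; true; false; _∧_; not)
  open import Data.Bool.Properties using (T?)
  open import Data.Empty using (⊥; ⊥-elim)
  open import Data.Fin.Base using (Fin; zero; suc; fromℕ<; inject≤)
  open import Data.Fin.Properties using (_≟_; any?; inject≤-injective)
  open import Data.Fin.Subset.Properties using (anySubset?)
  open import Data.List.Base
    using (List; []; _∷_; map; length; filter; concat; _++_; allFin; take; drop; cartesianProduct; lookup)
  import Data.List.Membership.DecPropositional as DecMembership
  open import Data.List.Membership.Propositional using (_∈_; _∉_; find; lose)
  open import Data.List.Membership.Propositional.Properties
    using (∈-allFin; ∈-concat⁺′; ∈-map⁺; ∈-cartesianProduct⁺; ∈-filter⁻; ∈-lookup)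
  import Data.List.Properties as List
  open import Data.List.Relation.Unary.All as All using (All; []; _∷_)
  open import Data.List.Relation.Unary.All.Properties using (¬Any⇒All¬)
  open import Data.List.Relation.Unary.AllPairs using ([]; _∷_)
  open import Data.List.Relation.Unary.Any as Any using (here; there)
  open import Data.List.Relation.Unary.Unique.Propositional using (Unique)
  import Data.List.Relation.Unary.Unique.Propositional.Properties as Unique
  open import Data.Maybe.Base using (just)
  open import Data.Nat.Base
  open import Data.Nat.DivMod using (_/_; m≡m%n+[m/n]*n; m%n<n; m/n*n≤m; m≥n⇒m/n>0)
  open import Data.Nat.ListAction using (sum)
  open import Data.Nat.ListAction.Properties using (sum-++)
  open import Data.Nat.Properties hiding (_≟_)
  open import Data.Product using (Σ; ∃; _×_; _,_; proj₁; proj₂; uncurry)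
  open import Data.Sum.Base using (_⊎_; inj₁; inj₂)
  open import Data.Vec.Base using (tabulate) renaming (lookup to lookupᵛ)
  open import Data.Vec.Properties using (lookup∘tabulate)
  open import Function.Base using (_∘_; id)
  open import Function.Definitions using (Injective)
  open import Relation.Nullary using (Dec; yes; no; does; _×-dec_)

  private variable
    X Y : Set

  -- Finite sums over lists, vertices and ordered pairs

  𝟙 : Bool → ℕ
  𝟙 true  = 1
  𝟙 false = 0

  𝟙≤1 : ∀ b → 𝟙 b ≤ 1
  𝟙≤1 true  = ≤-refl
  𝟙≤1 false = z≤n

  opaque

    ∑ : List X → (X → ℕ) → ℕ
    ∑ xs f = sum (map f xs)

    ∑-def : ∀ (xs : List X) (f : X → ℕ) → sum (map f xs) ≡ ∑ xs f
    ∑-def xs f = refl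

    ∑-[] : ∀ (f : X → ℕ) → ∑ [] f ≡ 0
    ∑-[] f = refl

    ∑-∷ : ∀ x (xs : List X) (f : X → ℕ) → ∑ (x ∷ xs) f ≡ f x + ∑ xs f
    ∑-∷ x xs f = refl

    ∑-cong : ∀ (xs : List X) {f g : X → ℕ} → (∀ x → f x ≡ g x) → ∑ xs f ≡ ∑ xs g
    ∑-cong []       e = refl
    ∑-cong (x ∷ xs) e = cong₂ _+_ (e x) (∑-cong xs e)

    ∑-mono : ∀ (xs : List X) {f g : X → ℕ} → (∀ x → f x ≤ g x) → ∑ xs f ≤ ∑ xs g
    ∑-mono []       h = z≤n
    ∑-mono (x ∷ xs) h = +-mono-≤ (h x) (∑-mono xs h)

    ∑-mono-< : ∀ {xs : List X} {f g : X → ℕ} {y} → (∀ x → f x ≤ g x) →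
               y ∈ xs → f y < g y → ∑ xs f < ∑ xs g
    ∑-mono-< {xs = _ ∷ xs} h (here refl) lt = +-mono-<-≤ lt (∑-mono xs h)
    ∑-mono-< {xs = x ∷ _}  h (there m)   lt = +-mono-≤-< (h x) (∑-mono-< h m lt)

    ∑-+ : ∀ (xs : List X) (f g : X → ℕ) → ∑ xs (λ x → f x + g x) ≡ ∑ xs f + ∑ xs g
    ∑-+ []       f g = refl
    ∑-+ (x ∷ xs) f g rewrite ∑-+ xs f g = interchange (f x) (g x) (∑ xs f) (∑ xs g)
      where
      interchange : ∀ a b c d → a + b + (c + d) ≡ a + c + (b + d)
      interchange = solve-∀

    ∑-*ˡ : ∀ (xs : List X) k (f : X → ℕ) → ∑ xs (λ x → k * f x) ≡ k * ∑ xs f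
    ∑-*ˡ []       k f = sym (*-zeroʳ k)
    ∑-*ˡ (x ∷ xs) k f rewrite ∑-*ˡ xs k f = sym (*-distribˡ-+ k (f x) _)

    ∑-*ʳ : ∀ (xs : List X) k (f : X → ℕ) → ∑ xs (λ x → f x * k) ≡ ∑ xs f * k
    ∑-*ʳ xs k f = trans (∑-cong xs (λ x → *-comm (f x) k)) (trans (∑-*ˡ xs k f) (*-comm k _))

    ∑-const : ∀ (xs : List X) k → ∑ xs (λ _ → k) ≡ length xs * k
    ∑-const []       k = refl
    ∑-const (x ∷ xs) k = cong (k +_) (∑-const xs k)

    ∑-zero : ∀ (xs : List X) → ∑ xs (λ _ → 0) ≡ 0
    ∑-zero xs = trans (∑-const xs 0) (*-zeroʳ (length xs))

    ∑-≤const : ∀ (xs : List X) {f : X → ℕ} {k} → (∀ x → f x ≤ k) → ∑ xs f ≤ length xs * k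
    ∑-≤const xs {k = k} h = ≤-trans (∑-mono xs h) (≤-reflexive (∑-const xs k))

    ∑-swap : ∀ (xs : List X) (ys : List Y) (f : X → Y → ℕ) →
             ∑ xs (λ x → ∑ ys (f x)) ≡ ∑ ys (λ y → ∑ xs (λ x → f x y))
    ∑-swap []       ys f = sym (∑-zero ys)
    ∑-swap (x ∷ xs) ys f = trans (cong (∑ ys (f x) +_) (∑-swap xs ys f))
                                 (sym (∑-+ ys (f x) (λ y → ∑ xs (λ z → f z y))))

    ∑-++ : ∀ (xs ys : List X) (f : X → ℕ) → ∑ (xs ++ ys) f ≡ ∑ xs f + ∑ ys f
    ∑-++ xs ys f = trans (cong sum (List.map-++ f xs ys)) (sum-++ (map f xs) (map f ys))

    ∑-concat : ∀ (xss : List (List X)) (f : X → ℕ) → ∑ (concat xss) f ≡ ∑ xss (λ xs → ∑ xs f)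
    ∑-concat []         f = refl
    ∑-concat (xs ∷ xss) f = trans (∑-++ xs (concat xss) f) (cong (∑ xs f +_) (∑-concat xss f))

    ∑-map : ∀ (xs : List X) (h : X → Y) (f : Y → ℕ) → ∑ (map h xs) f ≡ ∑ xs (f ∘ h)
    ∑-map xs h f = cong sum (sym (List.map-∘ xs))

    length≡∑ : ∀ (xs : List X) → length xs ≡ ∑ xs (λ _ → 1)
    length≡∑ xs = sym (trans (∑-const xs 1) (*-identityʳ _))

    ∈⇒≤∑ : ∀ {xs : List X} {x} (f : X → ℕ) → x ∈ xs → f x ≤ ∑ xs f
    ∈⇒≤∑ f (here refl) = m≤m+n _ _
    ∈⇒≤∑ f (there m)   = ≤-trans (∈⇒≤∑ f m) (m≤n+m _ _)

    ∑-positive : ∀ (xs : List X) (f : X → ℕ) → 0 < ∑ xs f → ∃ λ x → 0 < f x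
    ∑-positive (x ∷ xs) f h with f x in eq
    ... | zero  = ∑-positive xs f h
    ... | suc _ = x , subst (0 <_) (sym eq) z<s
    ∑-pigeonhole : ∀ (xs : List X) (f : X → ℕ) → 0 < length xs →
                   ∃ λ x → x ∈ xs × length xs * f x ≤ ∑ xs f
    ∑-pigeonhole (x ∷ []) f _ = x , here refl , ≤-refl
    ∑-pigeonhole (x ∷ xs@(_ ∷ _)) f _ with ∑-pigeonhole xs f z<s
    ... | y , y∈ , hy with ≤-total (f x) (f y)
    ... | inj₁ le = x , here refl , +-monoʳ-≤ (f x) (≤-trans (*-monoʳ-≤ (length xs) le) hy)
    ... | inj₂ ge = y , there y∈ , +-mono-≤ ge hy

    ∑-filter : ∀ {P : X → Set} (P? : ∀ x → Dec (P x)) (xs : List X) (f : X → ℕ) →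
               ∑ (filter P? xs) f ≡ ∑ xs (λ x → 𝟙 (does (P? x)) * f x)
    ∑-filter P? []       f = refl
    ∑-filter P? (x ∷ xs) f with does (P? x)
    ... | true  = cong₂ _+_ (sym (*-identityˡ (f x))) (∑-filter P? xs f)
    ... | false = ∑-filter P? xs f

  module _ {n : ℕ} where

    V : List (Fin n)
    V = allFin n

    δ : Fin n → Fin n → ℕ
    δ x y = 𝟙 (does (x ≟ y))

    δ-refl : ∀ x → δ x x ≡ 1
    δ-refl x with x ≟ x
    ... | yes _ = refl
    ... | no ¬p = ⊥-elim (¬p refl)

    δ-≢ : ∀ {x y} → x ≢ y → δ x y ≡ 0
    δ-≢ {x} {y} ne with x ≟ y
    ... | yes e = ⊥-elim (ne e)
    ... | no _  = refl

    δ-subst : ∀ (f : Fin n → ℕ) x y → δ x y * f y ≡ δ x y * f x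
    δ-subst f x y with x ≟ y
    ... | yes refl = refl
    ... | no _     = refl

    ∑-δ-∉ : ∀ {x} (xs : List (Fin n)) → x ∉ xs → ∑ xs (λ y → δ y x) ≡ 0
    ∑-δ-∉ []       h = ∑-[] _
    ∑-δ-∉ (y ∷ ys) h = trans (∑-∷ y ys _) (cong₂ _+_ (δ-≢ (λ e → h (here (sym e)))) (∑-δ-∉ ys (h ∘ there)))

    ∑-δ-unique : ∀ {xs} → Unique xs → ∀ x → ∑ xs (λ y → δ y x) ≤ 1
    ∑-δ-unique []                     x = ≤-trans (≤-reflexive (∑-[] _)) z≤n
    ∑-δ-unique (_∷_ {y} {ys} y∉ uniq) x rewrite ∑-∷ y ys (λ z → δ z x) with y ≟ x
    ... | yes refl = ≤-reflexive (cong suc (∑-δ-∉ ys (λ m → All.lookup y∉ m refl)))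
    ... | no _     = ∑-δ-unique uniq x

    ∑-δ : ∀ x → ∑ V (λ y → δ y x) ≡ 1
    ∑-δ x = ≤-antisym (∑-δ-unique (Unique.allFin⁺ n) x)
                      (subst (_≤ ∑ V (λ y → δ y x)) (δ-refl x) (∈⇒≤∑ (λ y → δ y x) (∈-allFin x)))

    δ-sym : ∀ x y → δ x y ≡ δ y x
    δ-sym x y with x ≟ y
    ... | yes refl = sym (δ-refl x)
    ... | no ne    = sym (δ-≢ (ne ∘ sym))

    ∑-δ-* : ∀ x (f : Fin n → ℕ) → ∑ V (λ y → δ x y * f y) ≡ f x
    ∑-δ-* x f = begin
      ∑ V (λ y → δ x y * f y)   ≡⟨ ∑-cong V (λ y → trans (δ-subst f x y) (cong (_* f x) (δ-sym x y))) ⟩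
      ∑ V (λ y → δ y x * f x)   ≡⟨ ∑-*ʳ V (f x) (λ y → δ y x) ⟩
      ∑ V (λ y → δ y x) * f x   ≡⟨ cong (_* f x) (∑-δ x) ⟩
      1 * f x                   ≡⟨ *-identityˡ (f x) ⟩
      f x                       ∎
      where open ≡-Reasoning

    -- Expanding `f x` as the sum of all `δ x y * f y` and exchanging the sums reduces the claim to
    -- each `y` occurring at most once.
    ∑-unique-≤ : ∀ {xs} → Unique xs → (f : Fin n → ℕ) → ∑ xs f ≤ ∑ V f
    ∑-unique-≤ {xs} uniq f = begin
      ∑ xs f                                  ≡⟨ ∑-cong xs (λ x → sym (∑-δ-* x f)) ⟩
      ∑ xs (λ x → ∑ V (λ y → δ x y * f y))    ≡⟨ ∑-swap xs V _ ⟩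
      ∑ V (λ y → ∑ xs (λ x → δ x y * f y))    ≡⟨ ∑-cong V (λ y → ∑-*ʳ xs (f y) (λ x → δ x y)) ⟩
      ∑ V (λ y → ∑ xs (λ x → δ x y) * f y)    ≤⟨ ∑-mono V (λ y → *-monoˡ-≤ (f y) (∑-δ-unique uniq y)) ⟩
      ∑ V (λ y → 1 * f y)                     ≡⟨ ∑-cong V (λ y → *-identityˡ (f y)) ⟩
      ∑ V f                                   ∎
      where open ≤-Reasoning

    opaque

      ∑₂ : (Fin n → Fin n → ℕ) → ℕ
      ∑₂ f = ∑ V (λ x → ∑ V (f x))

      ∑₂-def : ∀ f → ∑₂ f ≡ ∑ V (λ x → ∑ V (f x))
      ∑₂-def f = refl

      ∑₂-cong : ∀ {f g : Fin n → Fin n → ℕ} → (∀ x y → f x y ≡ g x y) → ∑₂ f ≡ ∑₂ g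
      ∑₂-cong h = ∑-cong V (λ x → ∑-cong V (h x))

      ∑₂-mono : ∀ {f g : Fin n → Fin n → ℕ} → (∀ x y → f x y ≤ g x y) → ∑₂ f ≤ ∑₂ g
      ∑₂-mono h = ∑-mono V (λ x → ∑-mono V (h x))

      ∑₂-+ : ∀ (f g : Fin n → Fin n → ℕ) → ∑₂ (λ x y → f x y + g x y) ≡ ∑₂ f + ∑₂ g
      ∑₂-+ f g = trans (∑-cong V (λ x → ∑-+ V (f x) (g x))) (∑-+ V _ _)

      ∑₂-*ˡ : ∀ k (f : Fin n → Fin n → ℕ) → ∑₂ (λ x y → k * f x y) ≡ k * ∑₂ f
      ∑₂-*ˡ k f = trans (∑-cong V (λ x → ∑-*ˡ V k (f x))) (∑-*ˡ V k _)

      ∑₂-*ʳ : ∀ k (f : Fin n → Fin n → ℕ) → ∑₂ (λ x y → f x y * k) ≡ ∑₂ f * k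
      ∑₂-*ʳ k f = trans (∑-cong V (λ x → ∑-*ʳ V k (f x))) (∑-*ʳ V k _)

      ∑₂-zero : ∑₂ (λ _ _ → 0) ≡ 0
      ∑₂-zero = trans (∑-cong V (λ _ → ∑-zero V)) (∑-zero V)

      ∑₂-positive : ∀ (f : Fin n → Fin n → ℕ) → 0 < ∑₂ f → ∃ λ x → ∃ λ y → 0 < f x y
      ∑₂-positive f h with ∑-positive V _ h
      ... | x , hx = x , ∑-positive V (f x) hx

      ∑₂-swap : ∀ (f : Fin n → Fin n → ℕ) → ∑₂ f ≡ ∑₂ (λ x y → f y x)
      ∑₂-swap f = ∑-swap V V f

      ∑₂-⊗ : ∀ (f g : Fin n → ℕ) → ∑₂ (λ x y → f x * g y) ≡ ∑ V f * ∑ V g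
      ∑₂-⊗ f g = trans (∑-cong V (λ x → ∑-*ˡ V (f x) g)) (∑-*ʳ V (∑ V g) f)

      ∑₂-mono-< : ∀ {f g : Fin n → Fin n → ℕ} → (∀ x y → f x y ≤ g x y) →
                  ∀ {u v} → f u v < g u v → ∑₂ f < ∑₂ g
      ∑₂-mono-< h {u} {v} lt =
        ∑-mono-< (λ x → ∑-mono V (h x)) (∈-allFin u) (∑-mono-< (h u) (∈-allFin v) lt)

    ∑₂-δδ-* : ∀ u v (f : Fin n → Fin n → ℕ) → ∑₂ (λ x y → δ u x * δ v y * f x y) ≡ f u v
    ∑₂-δδ-* u v f = begin
      ∑₂ (λ x y → δ u x * δ v y * f x y)          ≡⟨ ∑₂-cong (λ x y → *-assoc (δ u x) (δ v y) (f x y)) ⟩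
      ∑₂ (λ x y → δ u x * (δ v y * f x y))        ≡⟨ ∑₂-def _ ⟩
      ∑ V (λ x → ∑ V (λ y → δ u x * (δ v y * f x y))) ≡⟨ ∑-cong V (λ x → ∑-*ˡ V (δ u x) (λ y → δ v y * f x y)) ⟩
      ∑ V (λ x → δ u x * ∑ V (λ y → δ v y * f x y)) ≡⟨ ∑-δ-* u (λ x → ∑ V (λ y → δ v y * f x y)) ⟩
      ∑ V (λ y → δ v y * f u y)                   ≡⟨ ∑-δ-* v (f u) ⟩
      f u v                                       ∎
      where open ≡-Reasoning

  -- A vertex set all of whose cuts are dense

  module Cluster {n : ℕ} (w : Fin n → Fin n → ℕ) (P Q : ℕ) where

    private
      unit : Fin n → Fin n → ℕ
      unit _ _ = 1

    size : (Fin n → Bool) → ℕ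
    size A = ∑ V (λ x → 𝟙 (A x))

    -- Every cut is counted through ordered pairs, hence twice.
    boundary : (Fin n → Fin n → ℕ) → (Fin n → Bool) → ℕ
    boundary u A = ∑₂ (λ x y → u x y * ∣ 𝟙 (A x) - 𝟙 (A y) ∣)

    -- For `φ` the indicator of `B` this measures the cut of `A` into `A ∩ B` and `A ∖ B`, again
    -- over ordered pairs.
    variation : (Fin n → Fin n → ℕ) → (Fin n → Bool) → (Fin n → ℕ) → ℕ
    variation u A φ = ∑₂ (λ x y → u x y * (𝟙 (A x) * 𝟙 (A y) * ∣ φ x - φ y ∣))

    _∩_ _∖_ : (Fin n → Bool) → (Fin n → Bool) → Fin n → Bool
    (A ∩ B) x = A x ∧ B x
    (A ∖ B) x = A x ∧ not (B x)

    -- A pair inside `A` separated by `B` lies on the boundary of both parts, hence the factor 2; a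
    -- pair leaving `A` lies on the boundary of exactly one part.
    indicator-split : ∀ a b c d →
      ∣ 𝟙 (a ∧ c) - 𝟙 (b ∧ d) ∣ + ∣ 𝟙 (a ∧ not c) - 𝟙 (b ∧ not d) ∣
      ≡ ∣ 𝟙 a - 𝟙 b ∣ + 2 * (𝟙 a * 𝟙 b * ∣ 𝟙 c - 𝟙 d ∣)
    indicator-split true  true  true  true  = refl
    indicator-split true  true  true  false = refl
    indicator-split true  true  false true  = refl
    indicator-split true  true  false false = refl
    indicator-split true  false true  d     = refl
    indicator-split true  false false d     = refl
    indicator-split false true  c     true  = refl
    indicator-split false true  c     false = refl
    indicator-split false false c     d     = refl

    boundary-split : ∀ (u : Fin n → Fin n → ℕ) (A B : Fin n → Bool) →
      boundary u (A ∩ B) + boundary u (A ∖ B) ≡ boundary u A + 2 * variation u A (λ x → 𝟙 (B x))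
    boundary-split u A B = begin
      boundary u (A ∩ B) + boundary u (A ∖ B)                      ≡⟨ ∑₂-+ _ _ ⟨
      ∑₂ (λ x y → u x y * ∣ 𝟙 (A x ∧ B x) - 𝟙 (A y ∧ B y) ∣
                  + u x y * ∣ 𝟙 (A x ∧ not (B x)) - 𝟙 (A y ∧ not (B y)) ∣)
                                                                   ≡⟨ ∑₂-cong pointwise ⟩
      ∑₂ (λ x y → u x y * ∣ 𝟙 (A x) - 𝟙 (A y) ∣
                  + 2 * (u x y * (𝟙 (A x) * 𝟙 (A y) * ∣ 𝟙 (B x) - 𝟙 (B y) ∣)))
                                                                   ≡⟨ ∑₂-+ _ _ ⟩
      boundary u A + ∑₂ (λ x y → 2 * (u x y * (𝟙 (A x) * 𝟙 (A y) * ∣ 𝟙 (B x) - 𝟙 (B y) ∣)))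
                                                                   ≡⟨ cong (boundary u A +_) (∑₂-*ˡ 2 _) ⟩
      boundary u A + 2 * variation u A (λ x → 𝟙 (B x))             ∎
      where
      open ≡-Reasoning
      rearrange : ∀ k a b c d → a + b ≡ c + 2 * d → k * a + k * b ≡ k * c + 2 * (k * d)
      rearrange k a b c d e = begin
        k * a + k * b         ≡⟨ *-distribˡ-+ k a b ⟨
        k * (a + b)           ≡⟨ cong (k *_) e ⟩
        k * (c + 2 * d)       ≡⟨ distrib k c d ⟩
        k * c + 2 * (k * d)   ∎
        where
        distrib : ∀ k c d → k * (c + 2 * d) ≡ k * c + 2 * (k * d)
        distrib = solve-∀
      pointwise : ∀ x y → u x y * ∣ 𝟙 (A x ∧ B x) - 𝟙 (A y ∧ B y) ∣ + u x y * ∣ 𝟙 (A x ∧ not (B x)) - 𝟙 (A y ∧ not (B y)) ∣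
        ≡ u x y * ∣ 𝟙 (A x) - 𝟙 (A y) ∣ + 2 * (u x y * (𝟙 (A x) * 𝟙 (A y) * ∣ 𝟙 (B x) - 𝟙 (B y) ∣))
      pointwise x y = rearrange (u x y) _ _ ∣ 𝟙 (A x) - 𝟙 (A y) ∣ _ (indicator-split (A x) (A y) (B x) (B y))

    size-split : ∀ (A B : Fin n → Bool) → size (A ∩ B) + size (A ∖ B) ≡ size A
    size-split A B = trans (sym (∑-+ V _ _)) (∑-cong V (λ x → pointwise (A x) (B x)))
      where
      pointwise : ∀ a b → 𝟙 (a ∧ b) + 𝟙 (a ∧ not b) ≡ 𝟙 a
      pointwise true  true  = refl
      pointwise true  false = refl
      pointwise false _     = refl

    size-positive : ∀ A x → A x ≡ true → 0 < size A
    size-positive A x e = ≤-trans (≤-reflexive (sym (cong 𝟙 e))) (∈⇒≤∑ (λ y → 𝟙 (A y)) (∈-allFin x))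

    -- A violated cut is proper, so either part is strictly smaller than `A`; this drives the
    -- descent in `connected-part`.
    variation-positive : ∀ A B → 0 < variation unit A (λ x → 𝟙 (B x)) →
                         0 < size (A ∩ B) × 0 < size (A ∖ B)
    variation-positive A B h with ∑₂-positive _ h
    ... | x , y , hy = separated (A x) (A y) (B x) (B y) refl refl refl refl hy
      where
      both : ∀ {a b c} → a ≡ c → b ≡ true → c ≡ true → a ∧ b ≡ true
      both refl refl refl = refl
      diff : ∀ {a b c} → a ≡ c → b ≡ false → c ≡ true → a ∧ not b ≡ true
      diff refl refl refl = refl
      separated : ∀ a b c d → A x ≡ a → A y ≡ b → B x ≡ c → B y ≡ d →
                  0 < 1 * (𝟙 a * 𝟙 b * ∣ 𝟙 c - 𝟙 d ∣) → 0 < size (A ∩ B) × 0 < size (A ∖ B)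
      separated true true true false ax ay bx by _ =
        size-positive _ x (both ax bx refl) , size-positive _ y (diff ay by refl)
      separated true true false true ax ay bx by _ =
        size-positive _ y (both ay by refl) , size-positive _ x (diff ax bx refl)

    -- The weight `unit` is that of the complete graph, so both conditions compare the density of a
    -- cut with the threshold P / Q.
    Sparse Connected : (Fin n → Bool) → Set
    Sparse A = Q * boundary w A ≤ P * boundary unit A
    Connected A = ∀ (B : Fin n → Bool) → P * variation unit A (λ x → 𝟙 (B x)) ≤ Q * variation w A (λ x → 𝟙 (B x))

    -- If both parts had a boundary above the threshold, adding them would contradict
    -- `boundary-split`, whose right side combines a sparse boundary with an inner cut that is too
    -- sparse.
    sparse-part : ∀ A B → Sparse A →
                  Q * variation w A (λ x → 𝟙 (B x)) < P * variation unit A (λ x → 𝟙 (B x)) →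
                  Sparse (A ∩ B) ⊎ Sparse (A ∖ B)
    sparse-part A B sparse violated with Q * boundary w (A ∩ B) ≤? P * boundary unit (A ∩ B)
                                       | Q * boundary w (A ∖ B) ≤? P * boundary unit (A ∖ B)
    ... | yes h | _     = inj₁ h
    ... | no  _ | yes h = inj₂ h
    ... | no ¬p | no ¬q = ⊥-elim (<-irrefl refl (begin-strict
      Q * boundary w A + 2 * (Q * vw)                     <⟨ +-mono-≤-< sparse (*-monoʳ-< 2 violated) ⟩
      P * boundary unit A + 2 * (P * vu)                  ≡⟨ regroup P _ _ ⟩
      P * (boundary unit A + 2 * vu)                      ≡⟨ cong (P *_) (boundary-split unit A B) ⟨
      P * (boundary unit (A ∩ B) + boundary unit (A ∖ B)) ≡⟨ *-distribˡ-+ P _ _ ⟩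
      P * boundary unit (A ∩ B) + P * boundary unit (A ∖ B)
                                                          ≤⟨ +-mono-≤ (<⇒≤ (≰⇒> ¬p)) (<⇒≤ (≰⇒> ¬q)) ⟩
      Q * boundary w (A ∩ B) + Q * boundary w (A ∖ B)     ≡⟨ *-distribˡ-+ Q _ _ ⟨
      Q * (boundary w (A ∩ B) + boundary w (A ∖ B))       ≡⟨ cong (Q *_) (boundary-split w A B) ⟩
      Q * (boundary w A + 2 * vw)                         ≡⟨ regroup Q _ _ ⟨
      Q * boundary w A + 2 * (Q * vw)                     ∎))
      where
      open ≤-Reasoning
      vw = variation w A (λ x → 𝟙 (B x))
      vu = variation unit A (λ x → 𝟙 (B x))
      regroup : ∀ k a b → k * a + 2 * (k * b) ≡ k * (a + 2 * b)
      regroup = solve-∀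

    connected-part : ∀ k A → size A ≤ k → 0 < size A → Sparse A →
                     ∃ λ C → 0 < size C × Sparse C × Connected C
    connected-part zero    A ≤k pos sparse = ⊥-elim (<-irrefl refl (<-≤-trans pos ≤k))
    connected-part (suc k) A ≤k pos sparse
      -- Subsets are Boolean vectors, finite in number, so the search for a violated cut is
      -- decidable.
      with anySubset? (λ v → Q * variation w A (λ x → 𝟙 (lookupᵛ v x)) <? P * variation unit A (λ x → 𝟙 (lookupᵛ v x)))
    ... | no none = A , pos , sparse , λ B →
          subst₂ (λ a b → P * a ≤ Q * b) (same unit B) (same w B) (≮⇒≥ (λ lt → none (tabulate B , lt)))
      where
      same : ∀ (u : Fin n → Fin n → ℕ) B → variation u A (λ x → 𝟙 (lookupᵛ (tabulate B) x)) ≡ variation u A (λ x → 𝟙 (B x))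
      same u B = ∑₂-cong (λ x y → cong₂ (λ a b → u x y * (𝟙 (A x) * 𝟙 (A y) * ∣ 𝟙 a - 𝟙 b ∣))
                                        (lookup∘tabulate B x) (lookup∘tabulate B y))
    ... | yes (v , violated) with variation-positive A (lookupᵛ v) (positive _ _ violated)
      where
      positive : ∀ c b → c < P * b → 0 < b
      positive c zero    lt = ⊥-elim (n≮0 (subst (c <_) (*-zeroʳ P) lt))
      positive c (suc _) _  = z<s
    ... | ∩>0 , ∖>0 with sparse-part A (lookupᵛ v) sparse violated
    ... | inj₁ s = connected-part k _ (≤-pred (<-≤-trans (subst (size (A ∩ lookupᵛ v) <_) (size-split A (lookupᵛ v))
                                         (m<m+n _ ∖>0)) ≤k)) ∩>0 s
    ... | inj₂ s = connected-part k _ (≤-pred (<-≤-trans (subst (size (A ∖ lookupᵛ v) <_) (size-split A (lookupᵛ v))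
                                         (m<n+m _ ∩>0)) ≤k)) ∖>0 s

    -- The whole vertex set has empty boundary, hence is sparse and can start the descent.
    cluster : 0 < n → ∃ λ C → 0 < size C × Sparse C × Connected C
    cluster 0<n = connected-part (size (λ _ → true)) (λ _ → true) ≤-refl everything (≤-trans (≤-reflexive none) z≤n)
      where
      everything : 0 < size (λ _ → true)
      everything = subst (0 <_) (sym (trans (∑-const V 1) (trans (*-identityʳ _) (List.length-tabulate (λ (x : Fin n) → x))))) 0<n
      none : Q * boundary w (λ _ → true) ≡ 0
      none = trans (cong (Q *_) (trans (∑₂-cong (λ x y → *-zeroʳ (w x y))) ∑₂-zero)) (*-zeroʳ Q)

    -- Raising the truncation level from `k` to `suc k` lifts exactly the arguments above `k`, by
    -- one each; nothing cancels, since truncation is monotone.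
    ⊓-suc-variation : ∀ a b k → ∣ a ⊓ suc k - b ⊓ suc k ∣
                      ≡ ∣ a ⊓ k - b ⊓ k ∣ + ∣ 𝟙 (k <ᵇ a) - 𝟙 (k <ᵇ b) ∣
    ⊓-suc-variation zero    zero    k       = refl
    ⊓-suc-variation zero    (suc b) zero    rewrite ⊓-zeroʳ b = refl
    ⊓-suc-variation (suc a) zero    zero    rewrite ⊓-zeroʳ a = refl
    ⊓-suc-variation (suc a) (suc b) zero    rewrite ⊓-zeroʳ a | ⊓-zeroʳ b = refl
    ⊓-suc-variation zero    (suc b) (suc k) = cong suc (layer b k)
      where
      layer : ∀ b k → b ⊓ suc k ≡ b ⊓ k + 𝟙 (k <ᵇ b)
      layer zero    k       = refl
      layer (suc b) zero    = cong suc (⊓-zeroʳ b)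
      layer (suc b) (suc k) = cong suc (layer b k)
    ⊓-suc-variation (suc a) zero    (suc k) = cong suc (layer a k)
      where
      layer : ∀ b k → b ⊓ suc k ≡ b ⊓ k + ∣ 𝟙 (k <ᵇ b) - 0 ∣
      layer zero    k       = refl
      layer (suc b) zero    = cong suc (⊓-zeroʳ b)
      layer (suc b) (suc k) = cong suc (layer b k)
    ⊓-suc-variation (suc a) (suc b) (suc k) = ⊓-suc-variation a b k

    variation-⊓-suc : ∀ (u : Fin n → Fin n → ℕ) A (φ : Fin n → ℕ) k →
      variation u A (λ x → φ x ⊓ suc k)
      ≡ variation u A (λ x → φ x ⊓ k) + variation u A (λ x → 𝟙 (k <ᵇ φ x))
    variation-⊓-suc u A φ k = trans
      (∑₂-cong (λ x y → trans (cong (λ z → u x y * (𝟙 (A x) * 𝟙 (A y) * z)) (⊓-suc-variation (φ x) (φ y) k))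
                              (distrib (u x y) (𝟙 (A x) * 𝟙 (A y)) _ _)))
      (∑₂-+ _ _)
      where
      distrib : ∀ a b c d → a * (b * (c + d)) ≡ a * (b * c) + a * (b * d)
      distrib = solve-∀

    -- Layer-cake: a bounded function is the sum of the indicators of its superlevel sets.
    connected-variation : ∀ {A} → Connected A → ∀ (φ : Fin n → ℕ) K → (∀ x → φ x ≤ K) →
                          P * variation unit A φ ≤ Q * variation w A φ
    connected-variation {A} conn φ K bound = subst₂ (λ a b → P * a ≤ Q * b) (untruncate unit) (untruncate w) (truncated K)
      where
      untruncate : ∀ (u : Fin n → Fin n → ℕ) → variation u A (λ x → φ x ⊓ K) ≡ variation u A φ
      untruncate u = ∑₂-cong (λ x y → cong₂ (λ a b → u x y * (𝟙 (A x) * 𝟙 (A y) * ∣ a - b ∣))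
                                            (m≤n⇒m⊓n≡m (bound x)) (m≤n⇒m⊓n≡m (bound y)))
      truncated : ∀ k → P * variation unit A (λ x → φ x ⊓ k) ≤ Q * variation w A (λ x → φ x ⊓ k)
      truncated zero = ≤-trans (≤-reflexive (trans (cong (P *_) flat) (*-zeroʳ P))) z≤n
        where
        flat : variation unit A (λ x → φ x ⊓ 0) ≡ 0
        flat = trans (∑₂-cong (λ x y → trans (cong₂ (λ a b → 1 * (𝟙 (A x) * 𝟙 (A y) * ∣ a - b ∣)) (⊓-zeroʳ (φ x)) (⊓-zeroʳ (φ y)))
                                       (trans (*-identityˡ _) (*-zeroʳ (𝟙 (A x) * 𝟙 (A y))))))
                     ∑₂-zero
      truncated (suc k) = begin
        P * variation unit A (λ x → φ x ⊓ suc k)    ≡⟨ cong (P *_) (variation-⊓-suc unit A φ k) ⟩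
        P * (variation unit A (λ x → φ x ⊓ k) + _)  ≡⟨ *-distribˡ-+ P _ _ ⟩
        P * variation unit A (λ x → φ x ⊓ k) + P * _ ≤⟨ +-mono-≤ (truncated k) (conn (λ x → k <ᵇ φ x)) ⟩
        Q * variation w A (λ x → φ x ⊓ k) + Q * _   ≡⟨ *-distribˡ-+ Q _ _ ⟨
        Q * (variation w A (λ x → φ x ⊓ k) + _)     ≡⟨ cong (Q *_) (variation-⊓-suc w A φ k) ⟨
        Q * variation w A (λ x → φ x ⊓ suc k)       ∎
        where open ≤-Reasoning

  -- Cheap simple routes and a truncated distance

  module Routes {n : ℕ} (M c : Fin n → Fin n → ℕ) where

    open DecMembership (_≟_ {n}) using (_∈?_)

    cost : List (Fin n) → ℕ
    cost p = ∑ (edgesOf p) (uncurry c)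

    -- The cost is only bounded, so that a shortcut at a repeated vertex still counts as a route for
    -- the same bound.
    record Route (u v : Fin n) (k : ℕ) : Set where
      field
        vertices : List (Fin n)
        starts   : head? vertices ≡ just u
        ends     : last? vertices ≡ just v
        unique   : Unique vertices
        edges    : All (λ e → 0 < uncurry M e) (edgesOf vertices)
        cost≤    : cost vertices ≤ k
    open Route public

    weaken : ∀ {u v k l} → k ≤ l → Route u v k → Route u v l
    weaken k≤l r = record
      { vertices = vertices r ; starts = starts r ; ends = ends r
      ; unique = unique r ; edges = edges r ; cost≤ = ≤-trans (cost≤ r) k≤l }

    trivial : ∀ u → Route u u 0
    trivial u = record
      { vertices = u ∷ [] ; starts = refl ; ends = refl
      ; unique = [] ∷ [] ; edges = [] ; cost≤ = ≤-reflexive (∑-[] _) }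

    cost-∷ : ∀ x y p → cost (x ∷ y ∷ p) ≡ c x y + cost (y ∷ p)
    cost-∷ x y p = ∑-∷ (x , y) (edgesOf (y ∷ p)) (uncurry c)

    suffix : ∀ {u v} p → last? p ≡ just v → Unique p → All (λ e → 0 < uncurry M e) (edgesOf p) →
             u ∈ p → Route u v (cost p)
    suffix (x ∷ p)     l q          es       (here refl) = record
      { vertices = x ∷ p ; starts = refl ; ends = l ; unique = q ; edges = es ; cost≤ = ≤-refl }
    suffix (x ∷ y ∷ p) l (_ ∷ q) (_ ∷ es) (there m) =
      weaken (≤-trans (m≤n+m _ (c x y)) (≤-reflexive (sym (cost-∷ x y p)))) (suffix (y ∷ p) l q es m)

    -- If `x` already lies on the route, prepending it would repeat a vertex; the suffix starting at
    -- `x` is taken instead and costs no more.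
    prepend : ∀ {x u v k} → 0 < M x u → Route u v k → Route x v (c x u + k)
    prepend {x} {u} {k = k} pos r with x ∈? vertices r
    ... | yes x∈ = weaken (≤-trans (cost≤ r) (m≤n+m k (c x u)))
                          (suffix (vertices r) (ends r) (unique r) (edges r) x∈)
    ... | no x∉ with vertices r | starts r | ends r | unique r | edges r | cost≤ r
    ... | y ∷ p | refl | l | q | es | le = record
      { vertices = x ∷ y ∷ p ; starts = refl ; ends = l
      ; unique = ¬Any⇒All¬ (y ∷ p) x∉ ∷ q
      ; edges = pos ∷ es
      ; cost≤ = ≤-trans (≤-reflexive (cost-∷ x y p)) (+-monoʳ-≤ (c x y) le) }

    prependAll : ∀ {u v w l} p → head? p ≡ just u → last? p ≡ just v →
                 All (λ e → 0 < uncurry M e) (edgesOf p) → Route v w l → Route u w (cost p + l)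
    prependAll (x ∷ [])    refl refl es         r = weaken (m≤n+m _ _) r
    prependAll {l = l} (x ∷ y ∷ p) refl e (pos ∷ es) r =
      weaken (≤-reflexive (trans (sym (+-assoc (c x y) (cost (y ∷ p)) l)) (cong (_+ l) (sym (cost-∷ x y p)))))
             (prepend pos (prependAll (y ∷ p) refl e es r))

    compose : ∀ {u v w k l} → Route u v k → Route v w l → Route u w (k + l)
    compose {l = l} r s = weaken (+-monoˡ-≤ l (cost≤ r))
      (prependAll (vertices r) (starts r) (ends r) (edges r) s)

    module _ (T : ℕ) where

      -- The value `T` certifies nothing: only smaller values come with a route. The triangle
      -- inequality is kept apart, because it is reached only at the end of the relaxation.
      record RoutedDistance : Set where
        field
          dist       : Fin n → Fin n → ℕ
          dist≤T     : ∀ u v → dist u v ≤ T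
          dist-edge  : ∀ u v → 0 < M u v → dist u v ≤ c u v
          dist-route : ∀ u v → dist u v < T → Route u v (dist u v)
      open RoutedDistance public

      Triangular : RoutedDistance → Set
      Triangular d = ∀ u v w → dist d u w ≤ dist d u v + dist d v w

      edgeDistance : RoutedDistance
      edgeDistance = record
        { dist       = λ u v → truncated (M u v) (c u v)
        ; dist≤T     = λ u v → truncated≤T (M u v)
        ; dist-edge  = λ u v pos → truncated-edge pos
        ; dist-route = route
        }
        where
        truncated : ℕ → ℕ → ℕ
        truncated zero    k = T
        truncated (suc _) k = T ⊓ k
        truncated≤T : ∀ m {k} → truncated m k ≤ T
        truncated≤T zero    = ≤-refl
        truncated≤T (suc _) = m⊓n≤m T _
        truncated-edge : ∀ {m k} → 0 < m → truncated m k ≤ k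
        truncated-edge {suc _} _ = m⊓n≤n T _
        route : ∀ u v → truncated (M u v) (c u v) < T → Route u v (truncated (M u v) (c u v))
        route u v lt with M u v in eq
        ... | zero  = ⊥-elim (<-irrefl refl lt)
        ... | suc _ with ≤-total T (c u v)
        ...   | inj₁ T≤c = ⊥-elim (<-irrefl (m≤n⇒m⊓n≡m T≤c) lt)
        ...   | inj₂ c≤T = weaken (≤-reflexive (trans (+-identityʳ (c u v)) (sym (m≥n⇒m⊓n≡n c≤T))))
                                  (prepend (subst (0 <_) (sym eq) z<s) (trivial v))

      -- A relaxation step as in the Floyd-Warshall algorithm, with `v` as the intermediate vertex
      -- of all pairs at once.
      relax : RoutedDistance → Fin n → RoutedDistance
      relax d v = record
        { dist       = λ x y → dist d x y ⊓ (dist d x v + dist d v y)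
        ; dist≤T     = λ x y → ≤-trans (m⊓n≤m _ _) (dist≤T d x y)
        ; dist-edge  = λ x y pos → ≤-trans (m⊓n≤m _ _) (dist-edge d x y pos)
        ; dist-route = route
        }
        where
        route : ∀ x y → dist d x y ⊓ (dist d x v + dist d v y) < T →
                Route x y (dist d x y ⊓ (dist d x v + dist d v y))
        route x y lt with ≤-total (dist d x y) (dist d x v + dist d v y)
        ... | inj₁ le rewrite m≤n⇒m⊓n≡m le = dist-route d x y lt
        -- The sum is below `T`, hence so are both summands, and both come with routes.
        ... | inj₂ ge rewrite m≥n⇒m⊓n≡n ge =
          compose (dist-route d x v (≤-<-trans (m≤m+n _ _) lt)) (dist-route d v y (≤-<-trans (m≤n+m _ _) lt))

      relax-decreases : ∀ d u v w → dist d u v + dist d v w < dist d u w →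
                        ∑₂ (dist (relax d v)) < ∑₂ (dist d)
      relax-decreases d u v w lt = ∑₂-mono-< (λ x y → m⊓n≤m (dist d x y) _) (≤-<-trans (m⊓n≤n (dist d u w) _) lt)

      -- A violated triangle inequality is repaired by relaxing at its middle vertex. This lowers
      -- the sum of all values, which `k` bounds, so the process stops.
      metricClosure : ∀ k (d : RoutedDistance) → ∑₂ (dist d) ≤ k → Σ RoutedDistance Triangular
      metricClosure k d ≤k with any? (λ u → any? (λ v → any? (λ w → dist d u v + dist d v w <? dist d u w)))
      ... | no none = d , λ u v w → ≮⇒≥ (λ lt → none (u , v , w , lt))
      metricClosure zero    d ≤k | yes (u , v , w , lt) =
        ⊥-elim (n≮0 (<-≤-trans (relax-decreases d u v w lt) ≤k))
      metricClosure (suc k) d ≤k | yes (u , v , w , lt) =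
        metricClosure k (relax d v) (≤-pred (<-≤-trans (relax-decreases d u v w lt) ≤k))

      shortestRoutes : Σ RoutedDistance Triangular
      shortestRoutes = metricClosure _ edgeDistance ≤-refl

  -- Multiplicities, edge counts of paths and Eulerian balance

  sg : ℕ → ℕ
  sg zero    = 0
  sg (suc _) = 1

  isOne : ℕ → ℕ
  isOne 1 = 1
  isOne _ = 0

  sg-positive : ∀ {m} → 0 < m → sg m ≡ 1
  sg-positive {suc _} _ = refl

  sg≤1 : ∀ m → sg m ≤ 1
  sg≤1 zero    = z≤n
  sg≤1 (suc _) = ≤-refl

  sg≤id : ∀ m → sg m ≤ m
  sg≤id zero    = z≤n
  sg≤id (suc m) = s≤s z≤n

  isNull : ∀ {A : Set} → List A → ℕ
  isNull []      = 1
  isNull (_ ∷ _) = 0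

  module _ {n : ℕ} where

    count-∷ : ∀ (x y a b : Fin n) es → count x y ((a , b) ∷ es) ≡ δ a x * δ b y + count x y es
    count-∷ x y a b es with a ≟ x | b ≟ y
    ... | yes _ | yes _ = refl
    ... | yes _ | no _  = refl
    ... | no _  | yes _ = refl
    ... | no _  | no _  = refl

    count-++ : ∀ (x y : Fin n) es fs → count x y (es ++ fs) ≡ count x y es + count x y fs
    count-++ x y []             fs = refl
    count-++ x y ((a , b) ∷ es) fs
      rewrite count-∷ x y a b (es ++ fs) | count-∷ x y a b es | count-++ x y es fs
      = sym (+-assoc (δ a x * δ b y) (count x y es) (count x y fs))

    count-concat : ∀ {I : Set} (x y : Fin n) (p : I → List (Fin n × Fin n)) is →
                   count x y (concat (map p is)) ≡ ∑ is (λ i → count x y (p i))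
    count-concat x y p []       = sym (∑-[] _)
    count-concat x y p (i ∷ is) = trans (count-++ x y (p i) (concat (map p is)))
      (trans (cong (count x y (p i) +_) (count-concat x y p is)) (sym (∑-∷ i is _)))

    -- Double counting: it turns the effect of removing a path, a sum over ordered pairs, into a
    -- cost or a telescoping sum along the path.
    ∑₂-count : ∀ es (h : Fin n → Fin n → ℕ) → ∑₂ (λ x y → count x y es * h x y) ≡ ∑ es (uncurry h)
    ∑₂-count []             h = trans ∑₂-zero (sym (∑-[] _))
    ∑₂-count ((a , b) ∷ es) h = begin
      ∑₂ (λ x y → count x y ((a , b) ∷ es) * h x y)
        ≡⟨ ∑₂-cong (λ x y → trans (cong (_* h x y) (count-∷ x y a b es)) (*-distribʳ-+ (h x y) (δ a x * δ b y) _)) ⟩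
      ∑₂ (λ x y → δ a x * δ b y * h x y + count x y es * h x y)
        ≡⟨ ∑₂-+ _ _ ⟩
      ∑₂ (λ x y → δ a x * δ b y * h x y) + ∑₂ (λ x y → count x y es * h x y)
        ≡⟨ cong₂ _+_ (∑₂-δδ-* a b h) (∑₂-count es h) ⟩
      h a b + ∑ es (uncurry h)
        ≡⟨ ∑-∷ (a , b) es (uncurry h) ⟨
      ∑ ((a , b) ∷ es) (uncurry h) ∎
      where open ≡-Reasoning

    count-∉ : ∀ {x} (y : Fin n) p → x ∉ p → count x y (edgesOf p) ≡ 0
    count-∉ y []          x∉ = refl
    count-∉ y (a ∷ [])    x∉ = refl
    count-∉ {x} y (a ∷ b ∷ p) x∉ = trans (count-∷ x y a b (edgesOf (b ∷ p)))
      (cong₂ _+_ (cong (_* δ b y) (δ-≢ (x∉ ∘ here ∘ sym))) (count-∉ y (b ∷ p) (x∉ ∘ there)))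

    -- The tail of an edge does not recur on a simple path, so no edge is used twice.
    count-path≤ : ∀ (M : Fin n → Fin n → ℕ) p → Unique p → All (λ e → 0 < uncurry M e) (edgesOf p) →
                  ∀ x y → count x y (edgesOf p) ≤ sg (M x y)
    count-path≤ M []       _ _ x y = z≤n
    count-path≤ M (a ∷ []) _ _ x y = z≤n
    count-path≤ M (a ∷ b ∷ p) (a∉ ∷ uniq) (pos ∷ es) x y with a ≟ x | b ≟ y
    ... | yes refl | yes refl = ≤-reflexive (trans (cong suc (count-∉ y (b ∷ p) (λ m → All.lookup a∉ m refl)))
                                                   (sym (sg-positive pos)))
    ... | yes refl | no _     = count-path≤ M (b ∷ p) uniq es x y
    ... | no _     | _        = count-path≤ M (b ∷ p) uniq es x y

    -- The telescoping sum of φ y - φ x along the path, with the negative terms moved to the other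
    -- side.
    telescope : ∀ (φ : Fin n → ℕ) {u v} p → head? p ≡ just u → last? p ≡ just v →
                ∑ (edgesOf p) (φ ∘ proj₂) + φ u ≡ ∑ (edgesOf p) (φ ∘ proj₁) + φ v
    telescope φ (x ∷ [])        refl refl = cong (_+ φ x) (trans (∑-[] _) (sym (∑-[] _)))
    telescope φ {u} {v} (x ∷ y ∷ p) refl l    = begin
      ∑ ((x , y) ∷ es) (φ ∘ proj₂) + φ x   ≡⟨ cong (_+ φ x) (∑-∷ _ es _) ⟩
      φ y + ∑ es (φ ∘ proj₂) + φ x         ≡⟨ rotate (φ y) _ (φ x) ⟩
      ∑ es (φ ∘ proj₂) + φ y + φ x         ≡⟨ cong (_+ φ x) (telescope φ (y ∷ p) refl l) ⟩
      ∑ es (φ ∘ proj₁) + φ v + φ x         ≡⟨ rotate′ (φ x) _ (φ v) ⟩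
      φ x + ∑ es (φ ∘ proj₁) + φ v         ≡⟨ cong (_+ φ v) (∑-∷ _ es _) ⟨
      ∑ ((x , y) ∷ es) (φ ∘ proj₁) + φ v   ∎
      where
      open ≡-Reasoning
      es = edgesOf (y ∷ p)
      rotate : ∀ a b c → a + b + c ≡ b + a + c
      rotate = solve-∀
      rotate′ : ∀ a b c → b + c + a ≡ a + b + c
      rotate′ = solve-∀

    update : (Fin n → Fin n → List (Fin n)) → Fin n → Fin n → List (Fin n) → Fin n → Fin n → List (Fin n)
    update W u v p a b with u ≟ a | v ≟ b
    ... | yes _ | yes _ = p
    ... | yes _ | no _  = W a b
    ... | no _  | _     = W a b

    update-elim : ∀ (R : Fin n → Fin n → List (Fin n) → Set) W u v p →
                  R u v p → (∀ a b → R a b (W a b)) → ∀ a b → R a b (update W u v p a b)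
    update-elim R W u v p rp rW a b with u ≟ a | v ≟ b
    ... | yes refl | yes refl = rp
    ... | yes _    | no _     = rW a b
    ... | no _     | _        = rW a b

    update-≡ : ∀ W (u v : Fin n) p → update W u v p u v ≡ p
    update-≡ W u v p with u ≟ u | v ≟ v
    ... | yes _ | yes _ = refl
    ... | yes _ | no ¬q = ⊥-elim (¬q refl)
    ... | no ¬q | _     = ⊥-elim (¬q refl)

    -- The overwritten entry is empty, so overwriting adds `g p` and loses nothing.
    update-additive : ∀ (g : List (Fin n) → ℕ) → g [] ≡ 0 → ∀ W u v p → W u v ≡ [] →
                      ∀ a b → g (update W u v p a b) ≡ δ u a * δ v b * g p + g (W a b)
    update-additive g g[] W u v p e a b with u ≟ a | v ≟ b
    ... | yes refl | yes refl = sym (trans (cong₂ _+_ (*-identityˡ (g p)) (trans (cong g e) g[])) (+-identityʳ (g p)))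
    ... | yes _    | no _     = refl
    ... | no _     | _        = refl

    -- The value of `φ` at a vertex has its outdegree as coefficient on the left and its indegree on
    -- the right.
    balanced : ∀ (D : MultiDigraph n) → Eulerian D → ∀ (φ : Fin n → ℕ) →
               ∑₂ (λ x y → mult D x y * φ x) ≡ ∑₂ (λ x y → mult D x y * φ y)
    balanced D euler φ = begin
      ∑₂ (λ x y → mult D x y * φ x)   ≡⟨ ∑₂-def _ ⟩
      ∑ V (λ x → ∑ V (λ y → mult D x y * φ x)) ≡⟨ ∑-cong V (λ x → ∑-*ʳ V (φ x) (mult D x)) ⟩
      ∑ V (λ x → ∑ V (mult D x) * φ x)
        ≡⟨ ∑-cong V (λ x → cong (_* φ x) (trans (sym (∑-def V _)) (trans (sym (euler x)) (∑-def V _)))) ⟩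
      ∑ V (λ x → ∑ V (λ y → mult D y x) * φ x) ≡⟨ ∑-cong V (λ x → sym (∑-*ʳ V (φ x) (λ y → mult D y x))) ⟩
      ∑ V (λ x → ∑ V (λ y → mult D y x * φ x)) ≡⟨ ∑₂-def _ ⟨
      ∑₂ (λ x y → mult D y x * φ x)   ≡⟨ ∑₂-swap _ ⟩
      ∑₂ (λ x y → mult D x y * φ y)   ∎
      where open ≡-Reasoning

  -- Greedy removal of linking paths

  module Linking {n : ℕ} (D : MultiDigraph n) (euler : Eulerian D)
                 (A : Fin n → Bool) (T : ℕ) (demands : List (Fin n × Fin n)) where

    χ : Fin n → ℕ
    χ x = 𝟙 (A x)

    -- Only the last remaining copy of an edge inside A is charged, so the total
    -- cost of the residual digraph is at most |A|², whatever the multiplicities.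
    lastCopy : (Fin n → Fin n → ℕ) → Fin n → Fin n → ℕ
    lastCopy M x y = χ x * χ y * isOne (M x y)

    module R M = Routes M (lastCopy M)

    -- An empty `path` marks an unlinked pair. `exhausted` counts the ordered pairs in `A` that have
    -- lost all copies, `balance` is the Eulerian identity with an error of `T` per link, and
    -- `budget` records that every link has served a demand, which bounds `links`.
    record Linkage : Set where
      field
        path      : Fin n → Fin n → List (Fin n)
        residual  : Fin n → Fin n → ℕ
        links     : ℕ
        disjoint  : ∀ x y → residual x y + ∑₂ (λ u v → count x y (edgesOf (path u v))) ≡ mult D x y
        valid     : ∀ u v → path u v ≡ [] ⊎ IsPath D u v (path u v)
        exhausted : ∑₂ (λ x y → χ x * χ y * (sg (mult D x y) ∸ sg (residual x y))) ≤ links * T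
        balance   : ∀ (φ : Fin n → ℕ) → (∀ x → φ x ≤ T) →
                    ∑₂ (λ x y → residual x y * φ x) ≤ ∑₂ (λ x y → residual x y * φ y) + links * T
        budget    : links + ∑ demands (λ e → isNull (uncurry path e)) ≤ length demands
    open Linkage public

    unlinked : Linkage → ℕ
    unlinked L = ∑ demands (λ e → isNull (uncurry (path L) e))

    residual≤ : ∀ L x y → residual L x y ≤ mult D x y
    residual≤ L x y = subst (residual L x y ≤_) (disjoint L x y) (m≤m+n _ _)

    empty : Linkage
    empty = record
      { path = λ _ _ → [] ; residual = mult D ; links = 0
      ; disjoint  = λ x y → trans (cong (mult D x y +_) ∑₂-zero) (+-identityʳ _)
      ; valid     = λ _ _ → inj₁ refl
      ; exhausted = ≤-reflexive (trans
          (∑₂-cong (λ x y → trans (cong (χ x * χ y *_) (n∸n≡0 (sg (mult D x y)))) (*-zeroʳ (χ x * χ y))))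
          ∑₂-zero)
      ; balance   = λ φ _ → ≤-trans (≤-reflexive (balanced D euler φ)) (m≤m+n _ _)
      ; budget    = ≤-reflexive (sym (length≡∑ demands))
      }

    -- At most one copy is removed, so a pair newly loses all its copies only if exactly one was
    -- left, which is the charged case.
    exhaustion-step : ∀ m r k → k ≤ sg r → sg m ∸ sg (r ∸ k) ≤ (sg m ∸ sg r) + k * isOne r
    exhaustion-step m zero          zero _ = m≤m+n _ _
    exhaustion-step m (suc zero)    zero _ = m≤m+n _ _
    exhaustion-step zero    (suc zero) (suc zero) _ = z≤n
    exhaustion-step (suc m) (suc zero) (suc zero) _ = ≤-refl
    exhaustion-step m (suc (suc r)) zero _ = m≤m+n _ _
    exhaustion-step m (suc (suc r)) (suc zero) _ = m≤m+n _ _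
    exhaustion-step m (suc r) (suc (suc k)) (s≤s ())

    -- Removing a route of cost at most `T` exhausts at most `T` further pairs and shifts the
    -- balance by at most `T`, so all invariants survive with one more link.
    extend : (L : Linkage) → ∀ {u v k} → (u , v) ∈ demands → path L u v ≡ [] → k ≤ T →
             R.Route (residual L) u v k → Σ Linkage λ L′ → unlinked L′ < unlinked L
    extend L {u} {v} uv∈ new k≤T r = L′ , fewer
      where
      open Routes.Route r
      M = residual L
      p = vertices
      used : Fin n → Fin n → ℕ
      used x y = count x y (edgesOf p)
      used≤ : ∀ x y → used x y ≤ sg (M x y)
      used≤ = count-path≤ M p unique edges
      -- Truncated subtraction is exact here, since the route uses only copies that are present.
      restore : ∀ x y → (M x y ∸ used x y) + used x y ≡ M x y
      restore x y = m∸n+n≡m (≤-trans (used≤ x y) (sg≤id (M x y)))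
      p-nonempty : isNull p ≡ 0
      p-nonempty = nonempty p starts
        where
        nonempty : ∀ q → head? q ≡ just u → isNull q ≡ 0
        nonempty (_ ∷ _) _ = refl
      restore* : ∀ (h : Fin n → Fin n → ℕ) → ∑₂ (λ x y → M x y * h x y)
                 ≡ ∑₂ (λ x y → (M x y ∸ used x y) * h x y) + ∑ (edgesOf p) (uncurry h)
      restore* h = trans (∑₂-cong (λ x y → trans (cong (_* h x y) (sym (restore x y)))
                                                 (*-distribʳ-+ (h x y) (M x y ∸ used x y) (used x y))))
                         (trans (∑₂-+ _ _) (cong₂ _+_ refl (∑₂-count (edgesOf p) h)))

      nulls : ∀ a b → isNull (update (path L) u v p a b) ≤ isNull (path L a b)
      nulls = update-elim (λ a b q → isNull q ≤ isNull (path L a b)) (path L) u v p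
                          (≤-trans (≤-reflexive p-nonempty) z≤n) (λ _ _ → ≤-refl)
      fewer : ∑ demands (λ e → isNull (uncurry (update (path L) u v p) e)) < unlinked L
      fewer = ∑-mono-< (λ (a , b) → nulls a b) uv∈
        (subst₂ _<_ (sym (trans (cong isNull (update-≡ (path L) u v p)) p-nonempty)) (sym (cong isNull new)) z<s)

      L′ : Linkage
      L′ = record
        { path     = update (path L) u v p
        ; residual = λ x y → M x y ∸ used x y
        ; links    = suc (links L)
        ; disjoint = λ x y → begin-equality
            (M x y ∸ used x y) + ∑₂ (λ a b → count x y (edgesOf (update (path L) u v p a b)))
              ≡⟨ cong ((M x y ∸ used x y) +_) (trans (∑₂-cong (update-additive (count x y ∘ edgesOf) refl (path L) u v p new))
                   (trans (∑₂-+ _ _) (cong₂ _+_ (∑₂-δδ-* u v (λ _ _ → used x y)) refl))) ⟩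
            (M x y ∸ used x y) + (used x y + ∑₂ (λ a b → count x y (edgesOf (path L a b))))
              ≡⟨ trans (sym (+-assoc (M x y ∸ used x y) (used x y) _)) (cong₂ _+_ (restore x y) refl) ⟩
            M x y + ∑₂ (λ a b → count x y (edgesOf (path L a b)))
              ≡⟨ disjoint L x y ⟩
            mult D x y ∎
        ; valid = update-elim (λ a b q → q ≡ [] ⊎ IsPath D a b q) (path L) u v p
            (inj₂ (starts , ends , unique , All.map (λ {e} pos → <-≤-trans pos (residual≤ L _ _)) edges)) (valid L)
        ; exhausted = begin
            ∑₂ (λ x y → χ x * χ y * (sg (mult D x y) ∸ sg (M x y ∸ used x y)))
              ≤⟨ ∑₂-mono (λ x y → ≤-trans (*-monoʳ-≤ (χ x * χ y) (exhaustion-step (mult D x y) (M x y) (used x y) (used≤ x y)))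
                                          (≤-reflexive (distrib (χ x * χ y) _ (used x y) _))) ⟩
            ∑₂ (λ x y → χ x * χ y * (sg (mult D x y) ∸ sg (M x y)) + used x y * lastCopy M x y)
              ≡⟨ trans (∑₂-+ _ _) (cong₂ _+_ refl (∑₂-count (edgesOf p) (lastCopy M))) ⟩
            ∑₂ (λ x y → χ x * χ y * (sg (mult D x y) ∸ sg (M x y))) + ∑ (edgesOf p) (uncurry (lastCopy M))
              ≤⟨ +-mono-≤ (exhausted L) (≤-trans cost≤ k≤T) ⟩
            links L * T + T
              ≡⟨ +-comm (links L * T) T ⟩
            suc (links L) * T ∎
        ; balance = λ φ φ≤T → +-cancelʳ-≤ (∑ (edgesOf p) (φ ∘ proj₁)) _ _ (begin
            ∑₂ (λ x y → (M x y ∸ used x y) * φ x) + ∑ (edgesOf p) (φ ∘ proj₁)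
              ≡⟨ restore* (λ x y → φ x) ⟨
            ∑₂ (λ x y → M x y * φ x)
              ≤⟨ balance L φ φ≤T ⟩
            ∑₂ (λ x y → M x y * φ y) + links L * T
              ≡⟨ cong (_+ links L * T) (restore* (λ x y → φ y)) ⟩
            ∑₂ (λ x y → (M x y ∸ used x y) * φ y) + ∑ (edgesOf p) (φ ∘ proj₂) + links L * T
              -- Along the route `φ` changes by φ v - φ u in total; `φ u` is dropped, and `φ v` is
              -- bounded by `T` in the next step.
              ≤⟨ +-monoˡ-≤ (links L * T) (+-monoʳ-≤ _ (≤-trans (m≤m+n _ (φ u)) (≤-reflexive (telescope φ p starts ends)))) ⟩
            ∑₂ (λ x y → (M x y ∸ used x y) * φ y) + (∑ (edgesOf p) (φ ∘ proj₁) + φ v) + links L * T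
              ≤⟨ +-monoˡ-≤ (links L * T) (+-monoʳ-≤ (∑₂ (λ x y → (M x y ∸ used x y) * φ y))
                   (+-monoʳ-≤ (∑ (edgesOf p) (φ ∘ proj₁)) (φ≤T v))) ⟩
            ∑₂ (λ x y → (M x y ∸ used x y) * φ y) + (∑ (edgesOf p) (φ ∘ proj₁) + T) + links L * T
              ≡⟨ regroup (∑₂ (λ x y → (M x y ∸ used x y) * φ y)) (∑ (edgesOf p) (φ ∘ proj₁)) T (links L * T) ⟩
            ∑₂ (λ x y → (M x y ∸ used x y) * φ y) + suc (links L) * T + ∑ (edgesOf p) (φ ∘ proj₁) ∎)
        ; budget = ≤-trans (≤-reflexive (sym (+-suc (links L) _))) (≤-trans (+-monoʳ-≤ (links L) fewer) (budget L))
        }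
        where
        open ≤-Reasoning
        distrib : ∀ a b c d → a * (b + c * d) ≡ a * b + c * (a * d)
        distrib = solve-∀
        regroup : ∀ a b c d → a + (b + c) + d ≡ a + (c + d) + b
        regroup = solve-∀

    record Saturated : Set where
      field
        linkage   : Linkage
        distance  : R.RoutedDistance (residual linkage) T
        triangle  : R.Triangular (residual linkage) T distance
        saturated : ∀ u v → (u , v) ∈ demands → R.dist distance u v < T → IsPath D u v (path linkage u v)

    -- Every link lowers the number of unlinked demands, which `k` bounds. The distance is
    -- recomputed for each residual digraph, so the one returned belongs to the final residual.
    saturate : ∀ k (L : Linkage) → unlinked L ≤ k → Saturated
    saturate k L ≤k with R.shortestRoutes (residual L) T
    ... | d , tri with Any.any? (λ e → (0 <? isNull (uncurry (path L) e)) ×-dec (uncurry (R.dist d) e <? T)) demands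
    ... | no none = record { linkage = L ; distance = d ; triangle = tri ; saturated = sat }
      where
      sat : ∀ u v → (u , v) ∈ demands → R.dist d u v < T → IsPath D u v (path L u v)
      sat u v uv∈ lt with valid L u v
      ... | inj₂ isPath = isPath
      ... | inj₁ null   = ⊥-elim (none (lose uv∈ (subst (0 <_) (sym (cong isNull null)) z<s , lt)))
    ... | yes some with find some
    ... | (u , v) , uv∈ , unlinked , lt = continue k ≤k (extend L uv∈ (isNull⇒[] _ unlinked) (<⇒≤ lt) (R.dist-route d u v lt))
      where
      isNull⇒[] : ∀ (q : List (Fin n)) → 0 < isNull q → q ≡ []
      isNull⇒[] [] _ = refl
      continue : ∀ k → _ ≤ k → _ → Saturated
      continue zero    ≤k (L′ , lt′) = ⊥-elim (n≮0 (<-≤-trans lt′ ≤k))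
      continue (suc k) ≤k (L′ , lt′) = saturate k L′ (≤-pred (<-≤-trans lt′ ≤k))

  -- If f varies little in each variable separately and is at most 1 on the
  -- support of g, then compare f (u , v) with f (u′ , v′) through f (u , v′).
  module _ {X : Set} (xs : List X) (f g : X → X → ℕ) (P K : ℕ)
           (g≤1 : ∀ u v → g u v ≤ 1) (small : ∀ u v → g u v * f u v ≤ g u v)
           (rows : ∀ u → P * ∑ xs (λ v → ∑ xs (λ v′ → ∣ f u v - f u v′ ∣)) ≤ K)
           (cols : ∀ v → P * ∑ xs (λ u → ∑ xs (λ u′ → ∣ f u v - f u′ v ∣)) ≤ K) where

    private
      G S ℓ : ℕ
      G = ∑ xs (λ u → ∑ xs (g u))
      S = ∑ xs (λ u → ∑ xs (f u))
      ℓ = length xs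

      pointwise : ∀ u v u′ v′ → g u′ v′ * f u v ≤ g u′ v′ + ∣ f u v - f u v′ ∣ + ∣ f u v′ - f u′ v′ ∣
      pointwise u v u′ v′ = begin
        g′ * f u v
          ≤⟨ *-monoʳ-≤ g′ (≤-trans (m≤n+∣m-n∣ (f u v) (f u v′)) (+-monoˡ-≤ α (m≤n+∣m-n∣ (f u v′) (f u′ v′)))) ⟩
        g′ * (f u′ v′ + β + α)           ≡⟨ expand g′ (f u′ v′) β α ⟩
        g′ * f u′ v′ + g′ * (α + β)
          ≤⟨ +-mono-≤ (small u′ v′) (≤-trans (*-monoˡ-≤ (α + β) (g≤1 u′ v′)) (≤-reflexive (*-identityˡ _))) ⟩
        g′ + (α + β)                     ≡⟨ +-assoc g′ α β ⟨
        g′ + α + β                       ∎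
        where
        open ≤-Reasoning
        g′ = g u′ v′
        α = ∣ f u v - f u v′ ∣
        β = ∣ f u v′ - f u′ v′ ∣
        expand : ∀ a b c d → a * (b + c + d) ≡ a * b + a * (d + c)
        expand = solve-∀

      rowTerm colTerm : ℕ
      rowTerm = ∑ xs (λ u → ∑ xs (λ v → ℓ * ∑ xs (λ v′ → ∣ f u v - f u v′ ∣)))
      colTerm = ∑ xs (λ u → ℓ * ∑ xs (λ u′ → ∑ xs (λ v′ → ∣ f u v′ - f u′ v′ ∣)))

      -- `pointwise` is summed over all quadruples; a term picks up a factor `ℓ` from every variable
      -- it does not contain.
      summed : G * S ≤ ℓ * (ℓ * G) + rowTerm + colTerm
      summed = begin
        G * S
          ≡⟨ trans (∑-cong xs (λ u → ∑-*ˡ xs G (f u))) (∑-*ˡ xs G _) ⟨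
        ∑ xs (λ u → ∑ xs (λ v → G * f u v))
          ≡⟨ ∑-cong xs (λ u → ∑-cong xs (λ v → trans (∑-cong xs (λ u′ → ∑-*ʳ xs (f u v) (g u′))) (∑-*ʳ xs (f u v) _))) ⟨
        ∑ xs (λ u → ∑ xs (λ v → ∑ xs (λ u′ → ∑ xs (λ v′ → g u′ v′ * f u v))))
          ≤⟨ ∑-mono xs (λ u → ∑-mono xs (λ v → ∑-mono xs (λ u′ → ∑-mono xs (λ v′ → pointwise u v u′ v′)))) ⟩
        ∑ xs (λ u → ∑ xs (λ v → ∑ xs (λ u′ → ∑ xs (λ v′ → g u′ v′ + ∣ f u v - f u v′ ∣ + ∣ f u v′ - f u′ v′ ∣))))
          ≡⟨ ∑-cong xs (λ u → ∑-cong xs (λ v → split u v)) ⟩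
        ∑ xs (λ u → ∑ xs (λ v → G + ℓ * ∑ xs (λ v′ → ∣ f u v - f u v′ ∣)
                               + ∑ xs (λ u′ → ∑ xs (λ v′ → ∣ f u v′ - f u′ v′ ∣))))
          ≡⟨ ∑-cong xs (λ u → trans (∑-+ xs _ _) (cong₂ _+_ (trans (∑-+ xs _ _) (cong₂ _+_ (∑-const xs G) refl)) (∑-const xs _))) ⟩
        ∑ xs (λ u → ℓ * G + ∑ xs (λ v → ℓ * ∑ xs (λ v′ → ∣ f u v - f u v′ ∣))
                    + ℓ * ∑ xs (λ u′ → ∑ xs (λ v′ → ∣ f u v′ - f u′ v′ ∣)))
          ≡⟨ trans (∑-+ xs _ _) (cong₂ _+_ (trans (∑-+ xs _ _) (cong₂ _+_ (∑-const xs _) refl)) refl) ⟩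
        ℓ * (ℓ * G) + rowTerm + colTerm ∎
        where
        open ≤-Reasoning
        split : ∀ u v → ∑ xs (λ u′ → ∑ xs (λ v′ → g u′ v′ + ∣ f u v - f u v′ ∣ + ∣ f u v′ - f u′ v′ ∣))
                ≡ G + ℓ * ∑ xs (λ v′ → ∣ f u v - f u v′ ∣) + ∑ xs (λ u′ → ∑ xs (λ v′ → ∣ f u v′ - f u′ v′ ∣))
        split u v = trans
          (∑-cong xs (λ u′ → trans (∑-+ xs _ _) (cong₂ _+_ (∑-+ xs _ _) refl)))
          (trans (∑-+ xs _ _) (cong₂ _+_ (trans (∑-+ xs _ _) (cong₂ _+_ refl (∑-const xs _))) refl))

      rowTerm≤ : P * rowTerm ≤ ℓ * (ℓ * K)
      rowTerm≤ = begin
        P * rowTerm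
          ≡⟨ trans (∑-*ˡ xs P _) refl ⟨
        ∑ xs (λ u → P * ∑ xs (λ v → ℓ * ∑ xs (λ v′ → ∣ f u v - f u v′ ∣)))
          ≡⟨ ∑-cong xs (λ u → trans (cong (P *_) (∑-*ˡ xs ℓ _)) (exchange P ℓ _)) ⟩
        ∑ xs (λ u → ℓ * (P * ∑ xs (λ v → ∑ xs (λ v′ → ∣ f u v - f u v′ ∣))))
          ≤⟨ ∑-≤const xs (λ u → *-monoʳ-≤ ℓ (rows u)) ⟩
        ℓ * (ℓ * K) ∎
        where
        open ≤-Reasoning
        exchange : ∀ a b c → a * (b * c) ≡ b * (a * c)
        exchange = solve-∀

      colTerm≤ : P * colTerm ≤ ℓ * (ℓ * K)
      colTerm≤ = begin
        P * colTerm
          ≡⟨ cong (P *_) (∑-*ˡ xs ℓ _) ⟩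
        P * (ℓ * ∑ xs (λ u → ∑ xs (λ u′ → ∑ xs (λ v′ → ∣ f u v′ - f u′ v′ ∣))))
          ≡⟨ cong (λ z → P * (ℓ * z)) (trans (∑-cong xs (λ u → ∑-swap xs xs _)) (∑-swap xs xs _)) ⟩
        P * (ℓ * ∑ xs (λ v → ∑ xs (λ u → ∑ xs (λ u′ → ∣ f u v - f u′ v ∣))))
          ≡⟨ exchange P ℓ _ ⟩
        ℓ * (P * ∑ xs (λ v → ∑ xs (λ u → ∑ xs (λ u′ → ∣ f u v - f u′ v ∣))))
          ≡⟨ cong (ℓ *_) (∑-*ˡ xs P _) ⟨
        ℓ * ∑ xs (λ v → P * ∑ xs (λ u → ∑ xs (λ u′ → ∣ f u v - f u′ v ∣)))
          ≤⟨ *-monoʳ-≤ ℓ (∑-≤const xs cols) ⟩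
        ℓ * (ℓ * K) ∎
        where
        open ≤-Reasoning
        exchange : ∀ a b c → a * (b * c) ≡ b * (a * c)
        exchange = solve-∀

    -- In fractions, the mean of `f` is at most 1 + 2 K / (P G): the 1 comes from the support of
    -- `g`, and `K` enters once for each variable.
    averaging : P * (G * S) ≤ P * (ℓ * (ℓ * G)) + 2 * (ℓ * (ℓ * K))
    averaging = begin
      P * (G * S)                                        ≤⟨ *-monoʳ-≤ P summed ⟩
      P * (ℓ * (ℓ * G) + rowTerm + colTerm)              ≡⟨ distrib P (ℓ * (ℓ * G)) rowTerm colTerm ⟩
      P * (ℓ * (ℓ * G)) + (P * rowTerm + P * colTerm)    ≤⟨ +-monoʳ-≤ (P * (ℓ * (ℓ * G))) (+-mono-≤ rowTerm≤ colTerm≤) ⟩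
      P * (ℓ * (ℓ * G)) + (ℓ * (ℓ * K) + ℓ * (ℓ * K))    ≡⟨ cong (P * (ℓ * (ℓ * G)) +_) (double (ℓ * (ℓ * K))) ⟩
      P * (ℓ * (ℓ * G)) + 2 * (ℓ * (ℓ * K))              ∎
      where
      open ≤-Reasoning
      distrib : ∀ a b c d → a * (b + c + d) ≡ a * b + (a * c + a * d)
      distrib = solve-∀
      double : ∀ a → a + a ≡ 2 * a
      double = solve-∀

  -- Concentration of potentials on the cluster

  module Concentration {n : ℕ} (D : MultiDigraph n) (euler : Eulerian D)
      (A : Fin n → Bool) (T : ℕ) (demands : List (Fin n × Fin n))
      (w : Fin n → Fin n → ℕ) (w≤ : ∀ x y → w x y ≤ sg (mult D x y) + sg (mult D y x))
      (P Q : ℕ) where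

    open Linking D euler A T demands
    open Cluster w P Q

    inner : (Fin n → Fin n → ℕ) → ℕ
    inner h = ∑₂ (λ x y → χ x * χ y * h x y)

    module _ (L : Linkage) where

      private
        M = residual L
        a = size A
        N = links L

      lastCopy-total : ∑₂ (λ x y → χ x * χ y) ≡ a * a
      lastCopy-total = ∑₂-⊗ χ χ

      -- Balance makes the total ascent and the total descent of φ along edges nearly equal.
      residual-variation : ∀ (φ : Fin n → ℕ) → (∀ x → φ x ≤ T) →
        (∀ x y → 0 < M x y → φ y ≤ φ x + lastCopy M x y) →
        ∑₂ (λ x y → M x y * ∣ φ x - φ y ∣) ≤ 2 * (a * a) + N * T
      residual-variation φ φ≤T lip = +-cancelʳ-≤ (∑₂ (λ x y → M x y * φ y)) _ _ (begin
        ∑₂ (λ x y → M x y * ∣ φ x - φ y ∣) + ∑₂ (λ x y → M x y * φ y)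
          ≡⟨ ∑₂-+ _ _ ⟨
        ∑₂ (λ x y → M x y * ∣ φ x - φ y ∣ + M x y * φ y)
          ≤⟨ ∑₂-mono (λ x y → ascent (M x y) (χ x * χ y) (φ x) (φ y) (lip x y)) ⟩
        ∑₂ (λ x y → 2 * (χ x * χ y) + M x y * φ x)
          ≡⟨ trans (∑₂-+ _ _) (cong₂ _+_ (trans (∑₂-*ˡ 2 _) (cong (2 *_) lastCopy-total)) refl) ⟩
        2 * (a * a) + ∑₂ (λ x y → M x y * φ x)
          ≤⟨ +-monoʳ-≤ (2 * (a * a)) (balance L φ φ≤T) ⟩
        2 * (a * a) + (∑₂ (λ x y → M x y * φ y) + N * T)
          ≡⟨ regroup (2 * (a * a)) (∑₂ (λ x y → M x y * φ y)) (N * T) ⟩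
        2 * (a * a) + N * T + ∑₂ (λ x y → M x y * φ y) ∎)
        where
        open ≤-Reasoning
        regroup : ∀ a b c → a + (b + c) ≡ a + c + b
        regroup = solve-∀
        -- A charge occurs only at multiplicity one, so weighting it by the multiplicity does not
        -- increase it. This is how large multiplicities become harmless.
        isOne-* : ∀ m k → m * (k * isOne m) ≤ k
        isOne-* zero          k = z≤n
        isOne-* (suc zero)    k = ≤-reflexive (trans (+-identityʳ _) (*-identityʳ k))
        isOne-* (suc (suc m)) k = ≤-trans (≤-reflexive (trans (cong (suc (suc m) *_) (*-zeroʳ k)) (*-zeroʳ m))) z≤n
        -- On a descent the left side equals `s`; on an ascent it equals `s` plus twice the rise.
        ascent₁ : ∀ s t k → t ≤ s + k → ∣ s - t ∣ + t ≤ 2 * k + s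
        ascent₁ s t k t≤ with ≤-total s t
        ... | inj₂ t≤s = ≤-trans (≤-reflexive (trans (cong (_+ t) (m≤n⇒∣n-m∣≡n∸m t≤s)) (m∸n+n≡m t≤s))) (m≤n+m s _)
        ... | inj₁ s≤t = begin
          ∣ s - t ∣ + t   ≡⟨ cong (_+ t) (m≤n⇒∣m-n∣≡n∸m s≤t) ⟩
          (t ∸ s) + t     ≤⟨ +-mono-≤ (m≤n+o⇒m∸n≤o t s t≤) t≤ ⟩
          k + (s + k)     ≡⟨ double k s ⟩
          2 * k + s       ∎
          where
          double : ∀ k s → k + (s + k) ≡ 2 * k + s
          double = solve-∀
        ascent : ∀ m k s t → (0 < m → t ≤ s + k * isOne m) → m * ∣ s - t ∣ + m * t ≤ 2 * k + m * s
        ascent zero    k s t h = z≤n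
        ascent (suc m) k s t h = begin
          suc m * ∣ s - t ∣ + suc m * t               ≡⟨ *-distribˡ-+ (suc m) ∣ s - t ∣ t ⟨
          suc m * (∣ s - t ∣ + t)                     ≤⟨ *-monoʳ-≤ (suc m) (ascent₁ s t _ (h z<s)) ⟩
          suc m * (2 * (k * isOne (suc m)) + s)       ≡⟨ distrib (suc m) (k * isOne (suc m)) s ⟩
          2 * (suc m * (k * isOne (suc m))) + suc m * s ≤⟨ +-monoˡ-≤ (suc m * s) (*-monoʳ-≤ 2 (isOne-* (suc m) k)) ⟩
          2 * k + suc m * s                           ∎
          where
          distrib : ∀ a b c → a * (2 * b + c) ≡ 2 * (a * b) + a * c
          distrib = solve-∀

      present : Fin n → Fin n → ℕ
      present x y = sg (mult D x y)

      -- An adjacent pair has an edge in at least one direction, and by the symmetry of `h` both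
      -- directions contribute the same sum; hence the factor 2.
      adjacency≤ : ∀ (h : Fin n → Fin n → ℕ) → (∀ x y → h x y ≡ h y x) →
        ∑₂ (λ x y → w x y * (χ x * χ y * h x y)) ≤ 2 * inner (λ x y → present x y * h x y)
      adjacency≤ h h-sym = begin
        ∑₂ (λ x y → w x y * (χ x * χ y * h x y))
          ≤⟨ ∑₂-mono (λ x y → *-monoˡ-≤ _ (w≤ x y)) ⟩
        ∑₂ (λ x y → (present x y + present y x) * (χ x * χ y * h x y))
          ≡⟨ ∑₂-cong (λ x y → trans (distrib (present x y) (present y x) (χ x) (χ y) (h x y))
                                    (cong₂ _+_ refl (cong (λ z → χ y * χ x * (present y x * z)) (h-sym x y)))) ⟩
        ∑₂ (λ x y → χ x * χ y * (present x y * h x y) + χ y * χ x * (present y x * h y x))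
          ≡⟨ trans (∑₂-+ _ _) (cong₂ _+_ refl (∑₂-swap (λ x y → χ y * χ x * (present y x * h y x)))) ⟩
        inner (λ x y → present x y * h x y) + inner (λ x y → present x y * h x y)
          ≡⟨ cong (inner (λ x y → present x y * h x y) +_) (+-identityʳ _) ⟨
        2 * inner (λ x y → present x y * h x y) ∎
        where
        open ≤-Reasoning
        distrib : ∀ p q x y h → (p + q) * (x * y * h) ≡ x * y * (p * h) + y * x * (q * h)
        distrib = solve-∀

      -- The variation over the edges of D inside `A` is at most 3 a²: residual edges give 2 a², and
      -- `few` allows one more a² for the imbalance `N * T` together with `N * T` exhausted pairs of
      -- difference at most `T`. The two orientations double 3 to 6.
      concentration : Connected A → N * T + N * T * T ≤ a * a → ∀ (φ : Fin n → ℕ) → (∀ x → φ x ≤ T) →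
        (∀ x y → 0 < M x y → φ y ≤ φ x + lastCopy M x y) →
        P * inner (λ x y → ∣ φ x - φ y ∣) ≤ Q * (6 * (a * a))
      concentration conn few φ φ≤T lip = begin
        P * inner (λ x y → ∣ φ x - φ y ∣)
          ≡⟨ cong (P *_) (∑₂-cong (λ x y → *-identityˡ _)) ⟨
        P * variation (λ _ _ → 1) A φ
          ≤⟨ connected-variation {A} conn φ T φ≤T ⟩
        Q * variation w A φ
          ≤⟨ *-monoʳ-≤ Q (≤-trans (adjacency≤ (λ x y → ∣ φ x - φ y ∣) (λ x y → ∣-∣-comm (φ x) (φ y))) (*-monoʳ-≤ 2 edges≤)) ⟩
        Q * (2 * (3 * (a * a)))
          ≡⟨ cong (Q *_) (*-assoc 2 3 (a * a)) ⟨
        Q * (6 * (a * a)) ∎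
        where
        open ≤-Reasoning
        z≤T : ∀ x y → ∣ φ x - φ y ∣ ≤ T
        z≤T x y = ≤-trans (∣m-n∣≤m⊔n (φ x) (φ y)) (⊔-lub (φ≤T x) (φ≤T y))
        -- Either a residual copy carries the difference `z`, or the pair is exhausted and pays `T`.
        lost : ∀ m r k z → k ≤ 1 → z ≤ T → k * (sg m * z) ≤ r * z + k * (sg m ∸ sg r) * T
        lost m zero    k z _ z≤ = ≤-trans (*-monoʳ-≤ k (*-monoʳ-≤ (sg m) z≤)) (≤-reflexive (sym (*-assoc k (sg m) T)))
        lost m (suc r) k z k≤1 _ = ≤-trans (*-mono-≤ k≤1 (≤-trans (*-monoˡ-≤ z (sg≤1 m)) (≤-reflexive (*-identityˡ z))))
          (≤-trans (≤-reflexive (*-identityˡ z)) (≤-trans (m≤m+n z (r * z)) (m≤m+n _ _)))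
        edges≤ : inner (λ x y → present x y * ∣ φ x - φ y ∣) ≤ 3 * (a * a)
        edges≤ = begin
          inner (λ x y → present x y * ∣ φ x - φ y ∣)
            ≤⟨ ∑₂-mono (λ x y → lost (mult D x y) (M x y) (χ x * χ y) _ (*-mono-≤ (𝟙≤1 (A x)) (𝟙≤1 (A y))) (z≤T x y)) ⟩
          ∑₂ (λ x y → M x y * ∣ φ x - φ y ∣ + χ x * χ y * (present x y ∸ sg (M x y)) * T)
            ≡⟨ trans (∑₂-+ _ _) (cong₂ _+_ refl (∑₂-*ʳ T _)) ⟩
          ∑₂ (λ x y → M x y * ∣ φ x - φ y ∣) + inner (λ x y → present x y ∸ sg (M x y)) * T
            ≤⟨ +-mono-≤ (residual-variation φ φ≤T lip) (*-monoˡ-≤ T (exhausted L)) ⟩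
          2 * (a * a) + N * T + N * T * T
            ≡⟨ +-assoc (2 * (a * a)) (N * T) (N * T * T) ⟩
          2 * (a * a) + (N * T + N * T * T)
            ≤⟨ +-monoʳ-≤ (2 * (a * a)) few ⟩
          2 * (a * a) + a * a
            ≡⟨ triple (a * a) ⟩
          3 * (a * a) ∎
          where
          triple : ∀ b → 2 * b + b ≡ 3 * b
          triple = solve-∀

      -- An edge inside `A` either keeps a residual copy or is counted in `exhausted`; the factor 2
      -- is for the two orientations.
      surviving : inner w ≤ 2 * (inner (λ x y → sg (M x y)) + N * T)
      surviving = begin
        inner w
          ≡⟨ ∑₂-cong (λ x y → trans (*-comm (χ x * χ y) (w x y)) (cong (w x y *_) (sym (*-identityʳ _)))) ⟩
        ∑₂ (λ x y → w x y * (χ x * χ y * 1))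
          ≤⟨ adjacency≤ (λ _ _ → 1) (λ _ _ → refl) ⟩
        2 * inner (λ x y → present x y * 1)
          ≤⟨ *-monoʳ-≤ 2 (∑₂-mono (λ x y → ≤-trans (*-monoʳ-≤ (χ x * χ y)
               (≤-trans (≤-reflexive (*-identityʳ (present x y))) (m≤n+m∸n (present x y) (sg (M x y)))))
               (≤-reflexive (*-distribˡ-+ (χ x * χ y) (sg (M x y)) _)))) ⟩
        2 * ∑₂ (λ x y → χ x * χ y * sg (M x y) + χ x * χ y * (present x y ∸ sg (M x y)))
          ≡⟨ cong (2 *_) (∑₂-+ _ _) ⟩
        2 * (inner (λ x y → sg (M x y)) + inner (λ x y → present x y ∸ sg (M x y)))
          ≤⟨ *-monoʳ-≤ 2 (+-monoʳ-≤ (inner (λ x y → sg (M x y))) (exhausted L)) ⟩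
        2 * (inner (λ x y → sg (M x y)) + N * T) ∎
        where open ≤-Reasoning

  -- Choice of the cost bound and numerical estimates, with α = p / d

  m<[1+m/n]*n : ∀ m n .{{_ : NonZero n}} → m < suc (m / n) * n
  m<[1+m/n]*n m n = ≤-<-trans (≤-reflexive (m≡m%n+[m/n]*n m n)) (+-monoˡ-< (m / n * n) (m%n<n m n))

  module Arithmetic (p d n a : ℕ) (0<p : 0 < p) (0<n : 0 < n) (0<a : 0 < a)
                    (p≤d : p ≤ d) (a≤n : a ≤ n) (pn≤2da : p * n ≤ 2 * d * a) where

    open ≤-Reasoning

    private instance
      p≢0 : NonZero p
      p≢0 = >-nonZero 0<p
      n≢0 : NonZero n
      n≢0 = >-nonZero 0<n
      a≢0 : NonZero a
      a≢0 = >-nonZero 0<a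
      d≢0 : NonZero d
      d≢0 = >-nonZero (<-≤-trans 0<p p≤d)
      p²n≢0 : NonZero (p * p * n)
      p²n≢0 = m*n≢0 (p * p) n {{m*n≢0 p p}}

    -- In fractions α² n ≤ 2 a. It absorbs lower-order terms, such as a² into a³ / (α² n), and the
    -- rounding of `T`.
    p²n≤2d²a : p * p * n ≤ 2 * (d * d * a)
    p²n≤2d²a = begin
      p * p * n         ≡⟨ *-assoc p p n ⟩
      p * (p * n)       ≤⟨ *-mono-≤ p≤d pn≤2da ⟩
      d * (2 * d * a)   ≡⟨ regroup d a ⟩
      2 * (d * d * a)   ∎
      where
      regroup : ∀ d a → d * (2 * d * a) ≡ 2 * (d * d * a)
      regroup = solve-∀

    -- The mean distance is at most 194 a / (α² n). The 2 absorbs the distance 1 of surviving pairs;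
    -- 192 = 8 * 2 * 2 * 6 collects the density of `G`, the two variables, and the factors 2 d and 6
    -- of the concentration bound.
    average-distance : ∀ G S → p * n * a ≤ 8 * d * G →
      p * (G * S) ≤ p * (a * (a * G)) + 2 * (a * (a * (2 * d * (6 * (a * a))))) →
      p * p * n * S ≤ 194 * (d * d * (a * a * a))
    average-distance G S many h with ≤-total S (a * a)
    ... | inj₁ S≤ = begin
      p * p * n * S                   ≤⟨ *-mono-≤ p²n≤2d²a S≤ ⟩
      2 * (d * d * a) * (a * a)       ≡⟨ regroup 2 d a ⟩
      2 * (d * d * (a * a * a))       ≤⟨ *-monoˡ-≤ (d * d * (a * a * a)) (m≤m+n 2 192) ⟩
      194 * (d * d * (a * a * a))     ∎
      where
      regroup : ∀ k d a → k * (d * d * a) * (a * a) ≡ k * (d * d * (a * a * a))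
      regroup = solve-∀
    ... | inj₂ ≤S = begin
      p * p * n * S                                    ≡⟨ cong (p * p * n *_) (m+[n∸m]≡n ≤S) ⟨
      p * p * n * (a * a + Z)                          ≡⟨ *-distribˡ-+ (p * p * n) (a * a) Z ⟩
      p * p * n * (a * a) + p * p * n * Z
        ≤⟨ +-mono-≤ (≤-trans (*-monoˡ-≤ (a * a) p²n≤2d²a) (≤-reflexive (regroup 2 d a))) excess ⟩
      2 * (d * d * (a * a * a)) + 192 * (d * d * (a * a * a)) ≡⟨ *-distribʳ-+ (d * d * (a * a * a)) 2 192 ⟨
      194 * (d * d * (a * a * a))                      ∎
      where
      -- The excess of `S` over a mean distance of 1; splitting it off cancels the first term on the
      -- right of `h`.
      Z = S ∸ a * a
      regroup : ∀ k d a → k * (d * d * a) * (a * a) ≡ k * (d * d * (a * a * a))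
      regroup = solve-∀
      excess₁ : p * (G * Z) ≤ 2 * (a * (a * (2 * d * (6 * (a * a)))))
      excess₁ = +-cancelˡ-≤ (p * (a * (a * G))) _ _ (begin
        p * (a * (a * G)) + p * (G * Z)   ≡⟨ factor p a G Z ⟩
        p * (G * (a * a + Z))             ≡⟨ cong (λ z → p * (G * z)) (m+[n∸m]≡n ≤S) ⟩
        p * (G * S)                       ≤⟨ h ⟩
        p * (a * (a * G)) + 2 * (a * (a * (2 * d * (6 * (a * a))))) ∎)
        where
        factor : ∀ p a G Z → p * (a * (a * G)) + p * (G * Z) ≡ p * (G * (a * a + Z))
        factor = solve-∀
      excess : p * p * n * Z ≤ 192 * (d * d * (a * a * a))
      excess = *-cancelʳ-≤ _ _ a (begin
        p * p * n * Z * a                  ≡⟨ shuffle₁ p n Z a ⟩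
        p * n * a * (p * Z)                ≤⟨ *-monoˡ-≤ (p * Z) many ⟩
        8 * d * G * (p * Z)                ≡⟨ shuffle₂ 8 d G p Z ⟩
        8 * d * (p * (G * Z))              ≤⟨ *-monoʳ-≤ (8 * d) excess₁ ⟩
        8 * d * (2 * (a * (a * (2 * d * (6 * (a * a)))))) ≡⟨ shuffle₃ 8 2 2 6 d a ⟩
        192 * (d * d * (a * a * a)) * a    ∎)
        where
        shuffle₁ : ∀ p n Z a → p * p * n * Z * a ≡ p * n * a * (p * Z)
        shuffle₁ = solve-∀
        shuffle₂ : ∀ k d G p Z → k * d * G * (p * Z) ≡ k * d * (p * (G * Z))
        shuffle₂ = solve-∀
        shuffle₃ : ∀ k l m o d a → k * d * (l * (a * (a * (m * d * (o * (a * a)))))) ≡ k * l * m * o * (d * d * (a * a * a)) * a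
        shuffle₃ = solve-∀

    opaque

      -- 3104 = 16 * 194 is what `block-contradiction` requires. The successor rounds up and makes
      -- `T` positive; it costs one `p * p * n`, which turns 3104 into 3106 in `T-upper`.
      T : ℕ
      T = suc (3104 * (d * d * a) / (p * p * n))

      0<T : 0 < T
      0<T = z<s

      T-lower : 3104 * (d * d * a) ≤ p * p * n * T
      T-lower = <⇒≤ (<-≤-trans (m<[1+m/n]*n (3104 * (d * d * a)) (p * p * n)) (≤-reflexive (*-comm T (p * p * n))))

      T-upper : p * p * n * T ≤ 3106 * (d * d * a)
      T-upper = begin
        p * p * n * T                                ≡⟨ *-suc (p * p * n) _ ⟩
        p * p * n + p * p * n * (3104 * (d * d * a) / (p * p * n))
          ≡⟨ cong (p * p * n +_) (*-comm (p * p * n) (3104 * (d * d * a) / (p * p * n))) ⟩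
        p * p * n + 3104 * (d * d * a) / (p * p * n) * (p * p * n)
          ≤⟨ +-mono-≤ p²n≤2d²a (m/n*n≤m (3104 * (d * d * a)) (p * p * n)) ⟩
        2 * (d * d * a) + 3104 * (d * d * a)         ≡⟨ *-distribʳ-+ (d * d * a) 2 3104 ⟨
        3106 * (d * d * a)                           ∎

    -- In fractions 1 / α ≤ T, because a is at least α n / 2; `few-losses` uses it to trade a factor
    -- 1 / α for `T`.
    d≤pT : d ≤ p * T
    d≤pT = *-cancelˡ-≤ (2 * (d * a)) {{m*n≢0 2 (d * a) {{_}} {{m*n≢0 d a}}}} (begin
      2 * (d * a) * d           ≡⟨ shuffle₁ 2 d a ⟩
      2 * (d * d * a)           ≤⟨ *-monoˡ-≤ (d * d * a) (m≤m+n 2 3102) ⟩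
      3104 * (d * d * a)        ≤⟨ T-lower ⟩
      p * p * n * T             ≡⟨ shuffle₂ p n T ⟩
      p * n * (p * T)           ≤⟨ *-monoˡ-≤ (p * T) pn≤2da ⟩
      2 * d * a * (p * T)       ≡⟨ cong (_* (p * T)) (*-assoc 2 d a) ⟩
      2 * (d * a) * (p * T)     ∎)
      where
      shuffle₁ : ∀ k d a → k * (d * a) * d ≡ k * (d * d * a)
      shuffle₁ = solve-∀
      shuffle₂ : ∀ p n t → p * p * n * t ≡ p * n * (p * t)
      shuffle₂ = solve-∀

    module _ (s : ℕ) (s-small : 10 ^ 9 * (d * d * (d * d)) * s ≤ p * p * (p * p) * n) where

      -- As T is at most 3106 a / (α² n), the left side is at most 16 * 3106² s a² / (α⁴ n²); the
      -- bound on `s` and `a ≤ n` do the rest.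
      16sT²≤a : 16 * s * (T * T) ≤ a
      16sT²≤a = *-cancelʳ-≤ _ _ (B * B) {{m*n≢0 B B}} (begin
        16 * s * (T * T) * (B * B)             ≡⟨ shuffle₁ 16 s T B ⟩
        16 * (B * T) * (B * T) * s             ≤⟨ *-monoˡ-≤ s (*-mono-≤ (*-monoʳ-≤ 16 T-upper) T-upper) ⟩
        16 * (3106 * (d * d * a)) * (3106 * (d * d * a)) * s
                                               ≡⟨ shuffle₂ 16 3106 3106 d a s ⟩
        16 * 3106 * 3106 * (d * d * (d * d)) * s * (a * a)
          -- 16 * 3106 * 3106 is about 1.54 * 10⁸, which leaves room below 10⁹.
          ≤⟨ *-monoˡ-≤ (a * a) (*-monoˡ-≤ s (*-monoˡ-≤ (d * d * (d * d)) (m≤m+n (16 * 3106 * 3106) (10 ^ 9 ∸ 16 * 3106 * 3106)))) ⟩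
        10 ^ 9 * (d * d * (d * d)) * s * (a * a)  ≤⟨ *-monoˡ-≤ (a * a) s-small ⟩
        p * p * (p * p) * n * (a * a)          ≤⟨ *-monoʳ-≤ (p * p * (p * p) * n) (*-monoˡ-≤ a a≤n) ⟩
        p * p * (p * p) * n * (n * a)          ≡⟨ shuffle₃ p n a ⟩
        a * (B * B)                            ∎)
        where
        B = p * p * n
        shuffle₁ : ∀ k s T B → k * s * (T * T) * (B * B) ≡ k * (B * T) * (B * T) * s
        shuffle₁ = solve-∀
        shuffle₂ : ∀ k l m d a s → k * (l * (d * d * a)) * (m * (d * d * a)) * s ≡ k * l * m * (d * d * (d * d)) * s * (a * a)
        shuffle₂ = solve-∀
        shuffle₃ : ∀ p n a → p * p * (p * p) * n * (n * a) ≡ a * (p * p * n * (p * p * n))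
        shuffle₃ = solve-∀

      few-links : ∀ N → N ≤ a * (2 * s) → N * T + N * T * T ≤ a * a
      few-links N N≤ = begin
        N * T + N * T * T
          ≤⟨ +-monoˡ-≤ (N * T * T) (≤-trans (≤-reflexive (sym (*-identityʳ (N * T)))) (*-monoʳ-≤ (N * T) 0<T)) ⟩
        N * T * T + N * T * T         ≡⟨ double N T ⟩
        N * (2 * (T * T))             ≤⟨ *-monoˡ-≤ (2 * (T * T)) N≤ ⟩
        a * (2 * s) * (2 * (T * T))   ≡⟨ shuffle a s T 2 2 ⟩
        a * (4 * s * (T * T))         ≤⟨ *-monoʳ-≤ a (≤-trans (*-monoˡ-≤ (T * T) (*-monoˡ-≤ s (m≤m+n 4 12))) 16sT²≤a) ⟩
        a * a                         ∎
        where
        double : ∀ N T → N * T * T + N * T * T ≡ N * (2 * (T * T))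
        double = solve-∀
        shuffle : ∀ a s T k l → a * (k * s) * (l * (T * T)) ≡ a * (k * l * s * (T * T))
        shuffle = solve-∀

      -- The full factor 16 of `16sT²≤a` is spent here: 8 from the share to be protected and 2 from
      -- the bound on `N`.
      few-losses : ∀ N → N ≤ a * (2 * s) → 8 * d * (N * T) ≤ p * n * a
      few-losses N N≤ = begin
        8 * d * (N * T)                     ≤⟨ *-mono-≤ (*-monoʳ-≤ 8 d≤pT) (*-monoˡ-≤ T N≤) ⟩
        8 * (p * T) * (a * (2 * s) * T)     ≡⟨ shuffle 8 2 p T a s ⟩
        p * (16 * s * (T * T)) * a          ≤⟨ *-monoˡ-≤ a (*-monoʳ-≤ p (≤-trans 16sT²≤a a≤n)) ⟩
        p * n * a                           ∎
        where
        shuffle : ∀ k l p T a s → k * (p * T) * (a * (l * s) * T) ≡ p * (k * l * s * (T * T)) * a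
        shuffle = solve-∀

      2s≤a : 2 * s ≤ a
      2s≤a = begin
        2 * s                ≤⟨ *-monoˡ-≤ s (m≤m+n 2 14) ⟩
        16 * s               ≡⟨ *-identityʳ (16 * s) ⟨
        16 * s * 1           ≤⟨ *-monoʳ-≤ (16 * s) (*-mono-≤ 0<T 0<T) ⟩
        16 * s * (T * T)     ≤⟨ 16sT²≤a ⟩
        a                    ∎

    -- The density bound is added to itself: one `p * n * a` pays for the losses and the other
    -- remains.
    many-survive : ∀ I G NT → p * n * a ≤ 2 * d * I → I ≤ 2 * (G + NT) → 8 * d * NT ≤ p * n * a →
                   p * n * a ≤ 8 * d * G
    many-survive I G NT dense survive loss = +-cancelʳ-≤ (p * n * a) _ _ (begin
      p * n * a + p * n * a            ≤⟨ +-mono-≤ dense dense ⟩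
      2 * d * I + 2 * d * I            ≤⟨ +-mono-≤ (*-monoʳ-≤ (2 * d) survive) (*-monoʳ-≤ (2 * d) survive) ⟩
      2 * d * (2 * (G + NT)) + 2 * d * (2 * (G + NT)) ≡⟨ expand d G NT ⟩
      8 * d * G + 8 * d * NT           ≤⟨ +-monoʳ-≤ (8 * d * G) loss ⟩
      8 * d * G + p * n * a            ∎)
      where
      expand : ∀ d G N → 2 * d * (2 * (G + N)) + 2 * d * (2 * (G + N)) ≡ 8 * d * G + 8 * d * N
      expand = solve-∀

    -- With q ≥ a / (4 s) blocks, R > s a T / 2 would force S > a² T / 16, whereas S ≤ 194 a³ / (α²
    -- n) ≤ a² T / 16 by the choice of `T`.
    block-contradiction : ∀ s q R S → p * p * n * S ≤ 194 * (d * d * (a * a * a)) →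
      a ≤ 2 * (q * (2 * s)) → q * R ≤ 2 * S → s * (a * T) < 2 * R → ⊥
    block-contradiction s q R S S≤ a≤ qR≤ lt = <-irrefl refl (begin-strict
      s * (a * T) * (a * B)                        <⟨ *-monoˡ-< (a * B) {{m*n≢0 a B}} lt ⟩
      2 * R * (a * B)                              ≤⟨ *-monoʳ-≤ (2 * R) (*-monoˡ-≤ B a≤) ⟩
      2 * R * (2 * (q * (2 * s)) * B)              ≡⟨ shuffle₁ 2 2 2 R q s B ⟩
      8 * s * B * (q * R)                          ≤⟨ *-monoʳ-≤ (8 * s * B) qR≤ ⟩
      8 * s * B * (2 * S)                          ≡⟨ shuffle₂ 8 2 s B S ⟩
      16 * s * (B * S)                             ≤⟨ *-monoʳ-≤ (16 * s) S≤ ⟩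
      16 * s * (194 * (d * d * (a * a * a)))       ≡⟨ shuffle₃ 16 194 s d a ⟩
      s * a * a * (3104 * (d * d * a))             ≤⟨ *-monoʳ-≤ (s * a * a) T-lower ⟩
      s * a * a * (B * T)                          ≡⟨ shuffle₄ s a B T ⟩
      s * (a * T) * (a * B)                        ∎)
      where
      B = p * p * n
      shuffle₁ : ∀ k l m R q s B → k * R * (l * (q * (m * s)) * B) ≡ k * l * m * s * B * (q * R)
      shuffle₁ = solve-∀
      shuffle₂ : ∀ k l s B S → k * s * B * (l * S) ≡ k * l * s * (B * S)
      shuffle₂ = solve-∀
      shuffle₃ : ∀ k l s d a → k * s * (l * (d * d * (a * a * a))) ≡ s * a * a * (k * l * (d * d * a))
      shuffle₃ = solve-∀
      shuffle₄ : ∀ s a B T → s * a * a * (B * T) ≡ s * (a * T) * (a * B)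
      shuffle₄ = solve-∀

  -- Blocks, demands and branch vertices

  lookup-injective : ∀ {xs : List X} → Unique xs → ∀ {i j} → lookup xs i ≡ lookup xs j → i ≡ j
  lookup-injective (_   ∷ _) {zero}  {zero}  _ = refl
  lookup-injective (x∉ ∷ _) {zero}  {suc j} e = ⊥-elim (All.lookup x∉ (∈-lookup j) e)
  lookup-injective (x∉ ∷ _) {suc i} {zero}  e = ⊥-elim (All.lookup x∉ (∈-lookup i) (sym e))
  lookup-injective (_   ∷ u) {suc i} {suc j} e = cong suc (lookup-injective u e)

  ∑-injective-≤ : ∀ {s n} {f : Fin s → Fin n} → Injective _≡_ _≡_ f → ∀ g →
                  ∑ (allFin s) (g ∘ f) ≤ ∑ (allFin n) g
  ∑-injective-≤ {s} {f = f} inj g =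
    ≤-trans (≤-reflexive (sym (∑-map (allFin s) f g))) (∑-unique-≤ (Unique.map⁺ inj (Unique.allFin⁺ s)) g)

  -- The local function of kedges has no name outside Defs: it is recovered by unification.
  mutual
    edgesFrom : ∀ s → Fin s → List (Fin s) → List (Kedge s)
    edgesFrom = _

    kedges≡ : ∀ s → kedges s ≡ concat (map (λ i → edgesFrom s i (allFin s)) (allFin s))
    kedges≡ s with allFin s
    ... | xs = refl

  ∑-edgesFrom≤ : ∀ {s} i (js : List (Fin s)) (h : Fin s → Fin s → ℕ) →
                 ∑ (edgesFrom s i js) (uncurry h ∘ proj₁) ≤ ∑ js (h i)
  ∑-edgesFrom≤ i []       h = ≤-reflexive (trans (∑-[] _) (sym (∑-[] _)))
  ∑-edgesFrom≤ i (j ∷ js) h with i ≟ j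
  ... | yes _ = ≤-trans (∑-edgesFrom≤ i js h) (≤-trans (m≤n+m _ (h i j)) (≤-reflexive (sym (∑-∷ j js (h i)))))
  ... | no _  = ≤-trans (≤-reflexive (∑-∷ _ _ _))
                  (≤-trans (+-monoʳ-≤ (h i j) (∑-edgesFrom≤ i js h)) (≤-reflexive (sym (∑-∷ j js (h i)))))

  ∑-kedges≤ : ∀ s (h : Fin s → Fin s → ℕ) →
              ∑ (kedges s) (uncurry h ∘ proj₁) ≤ ∑ (allFin s) (λ i → ∑ (allFin s) (h i))
  ∑-kedges≤ s h = begin
    ∑ (kedges s) (uncurry h ∘ proj₁)
      ≡⟨ cong (λ es → ∑ es (uncurry h ∘ proj₁)) (kedges≡ s) ⟩
    ∑ (concat (map (λ i → edgesFrom s i (allFin s)) (allFin s))) (uncurry h ∘ proj₁)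
      ≡⟨ trans (∑-concat (map (λ i → edgesFrom s i (allFin s)) (allFin s)) _) (∑-map (allFin s) _ _) ⟩
    ∑ (allFin s) (λ i → ∑ (edgesFrom s i (allFin s)) (uncurry h ∘ proj₁))
      ≤⟨ ∑-mono (allFin s) (λ i → ∑-edgesFrom≤ i (allFin s) h) ⟩
    ∑ (allFin s) (λ i → ∑ (allFin s) (h i)) ∎
    where open ≤-Reasoning

  -- Whatever follows the first `q` pieces is discarded, so that all pieces are full when `q * σ`
  -- does not exceed the length.
  chunks : ℕ → ℕ → List X → List (List X)
  chunks σ zero    xs = []
  chunks σ (suc q) xs = take σ xs ∷ chunks σ q (drop σ xs)

  length-chunks : ∀ σ q (xs : List X) → length (chunks σ q xs) ≡ q
  length-chunks σ zero    xs = refl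
  length-chunks σ (suc q) xs = cong suc (length-chunks σ q (drop σ xs))

  chunks-length : ∀ σ q (xs : List X) → q * σ ≤ length xs → All (λ b → length b ≡ σ) (chunks σ q xs)
  chunks-length σ zero    xs h = []
  chunks-length σ (suc q) xs h =
    trans (List.length-take σ xs) (m≤n⇒m⊓n≡m (≤-trans (m≤m+n σ _) h)) ∷
    chunks-length σ q (drop σ xs) (≤-trans (≤-reflexive (sym (m+n∸m≡n σ (q * σ))))
      (≤-trans (∸-monoˡ-≤ σ h) (≤-reflexive (sym (List.length-drop σ xs)))))

  chunks-unique : ∀ σ q {xs : List X} → Unique xs → All Unique (chunks σ q xs)
  chunks-unique σ zero    u = []
  chunks-unique σ (suc q) u = Unique.take⁺ σ u ∷ chunks-unique σ q (Unique.drop⁺ σ u)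

  ∑-chunks≤ : ∀ σ q (xs : List X) f → ∑ (chunks σ q xs) (λ b → ∑ b f) ≤ ∑ xs f
  ∑-chunks≤ σ zero    xs f = ≤-trans (≤-reflexive (∑-[] _)) z≤n
  ∑-chunks≤ σ (suc q) xs f = begin
    ∑ (take σ xs ∷ chunks σ q (drop σ xs)) (λ b → ∑ b f)            ≡⟨ ∑-∷ _ _ _ ⟩
    ∑ (take σ xs) f + ∑ (chunks σ q (drop σ xs)) (λ b → ∑ b f)      ≤⟨ +-monoʳ-≤ _ (∑-chunks≤ σ q (drop σ xs) f) ⟩
    ∑ (take σ xs) f + ∑ (drop σ xs) f                               ≡⟨ ∑-++ (take σ xs) (drop σ xs) f ⟨
    ∑ (take σ xs ++ drop σ xs) f                                    ≡⟨ cong (λ ys → ∑ ys f) (List.take++drop≡id σ xs) ⟩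
    ∑ xs f                                                          ∎
    where open ≤-Reasoning

  ∑-All : ∀ {xs : List X} {f : X → ℕ} {k} → All (λ x → f x ≡ k) xs → ∑ xs f ≡ length xs * k
  ∑-All []         = ∑-[] _
  ∑-All (e ∷ es) = trans (∑-∷ _ _ _) (cong₂ _+_ e (∑-All es))

  -- Ordered pairs, diagonal included: a block of size σ gives exactly σ² demands.
  squares : List (List X) → List (X × X)
  squares bs = concat (map (λ b → cartesianProduct b b) bs)

  length-cartesianProduct : ∀ (xs ys : List X) → length (cartesianProduct xs ys) ≡ length xs * length ys
  length-cartesianProduct []       ys = refl
  length-cartesianProduct (x ∷ xs) ys = trans (List.length-++ (map (x ,_) ys))
    (cong₂ _+_ (List.length-map (x ,_) ys) (length-cartesianProduct xs ys))

  length-squares : ∀ σ (bs : List (List X)) → All (λ b → length b ≡ σ) bs →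
                   length (squares bs) ≡ length bs * (σ * σ)
  length-squares σ bs ls = begin
    length (squares bs)                                   ≡⟨ length≡∑ (squares bs) ⟩
    ∑ (squares bs) (λ _ → 1)                              ≡⟨ trans (∑-concat (map (λ b → cartesianProduct b b) bs) _) (∑-map bs _ _) ⟩
    ∑ bs (λ b → ∑ (cartesianProduct b b) (λ _ → 1))       ≡⟨ ∑-cong bs (λ b → sym (length≡∑ (cartesianProduct b b))) ⟩
    ∑ bs (λ b → length (cartesianProduct b b))
      ≡⟨ ∑-All (All.map (λ {b} e → trans (length-cartesianProduct b b) (cong₂ _*_ e e)) ls) ⟩
    length bs * (σ * σ)                                   ∎
    where open ≡-Reasoning

  ∈-squares : ∀ {bs : List (List X)} {b x y} → b ∈ bs → x ∈ b → y ∈ b → (x , y) ∈ squares bs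
  ∈-squares b∈ x∈ y∈ = ∈-concat⁺′ (∈-cartesianProduct⁺ x∈ y∈) (∈-map⁺ (λ b → cartesianProduct b b) b∈)

  module Links {n : ℕ} (D : MultiDigraph n) (euler : Eulerian D) (A : Fin n → Bool) (T : ℕ)
               (demands : List (Fin n × Fin n)) where

    open Linking D euler A T demands

    -- The branch vertices are the first `s` entries of `xs`. Distinct edges of the complete digraph
    -- use distinct vertex pairs, so their joint load is part of the sum in `disjoint`.
    immersion : ∀ {s} (L : Linkage) (xs : List (Fin n)) → Unique xs → s ≤ length xs →
                (∀ {u v} → u ∈ xs → v ∈ xs → IsPath D u v (path L u v)) → ImmersesK D s
    immersion {s} L xs uniq s≤ paths = f , f-injective , P , (λ e → paths (∈-lookup _) (∈-lookup _)) , fits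
      where
      open ≤-Reasoning
      f : Fin s → Fin n
      f i = lookup xs (inject≤ i s≤)
      f-injective : Injective _≡_ _≡_ f
      f-injective e = inject≤-injective s≤ s≤ _ _ (lookup-injective uniq e)
      P : Kedge s → List (Fin n)
      P ((i , j) , _) = path L (f i) (f j)
      fits : ∀ x y → count x y (concat (map (λ e → edgesOf (P e)) (kedges s))) ≤ mult D x y
      fits x y = begin
        count x y (concat (map (λ e → edgesOf (P e)) (kedges s)))
          ≡⟨ count-concat x y (λ e → edgesOf (P e)) (kedges s) ⟩
        ∑ (kedges s) (λ e → count x y (edgesOf (P e)))
          ≤⟨ ∑-kedges≤ s (λ i j → load (f i) (f j)) ⟩
        ∑ (allFin s) (λ i → ∑ (allFin s) (λ j → load (f i) (f j)))
          ≤⟨ ∑-mono (allFin s) (λ i → ∑-injective-≤ f-injective (load (f i))) ⟩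
        ∑ (allFin s) (λ i → ∑ V (load (f i)))
          ≤⟨ ∑-injective-≤ f-injective (λ u → ∑ V (load u)) ⟩
        ∑ V (λ u → ∑ V (load u))
          ≡⟨ ∑₂-def load ⟨
        ∑₂ load
          ≤⟨ m≤n+m _ (residual L x y) ⟩
        residual L x y + ∑₂ load
          ≡⟨ disjoint L x y ⟩
        mult D x y ∎
        where
        load : Fin n → Fin n → ℕ
        load u v = count x y (edgesOf (path L u v))

  module Centrality {n : ℕ} (as : List (Fin n)) (f : Fin n → Fin n → ℕ) (T : ℕ)
           (triangle : ∀ u v w → f u w ≤ f u v + f v w) where

    private
      a = length as

    remoteness : Fin n → ℕ
    remoteness u = ∑ as (λ w → f u w + f w u)

    central? : ∀ u → Dec (2 * remoteness u < a * T)
    central? u = 2 * remoteness u <? a * T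

    -- The triangle inequality is summed over all intermediate `w` in `as`: then a * f u v is at
    -- most the sum of the two remotenesses, each below a T / 2.
    central-close : ∀ {u v} → 2 * remoteness u < a * T → 2 * remoteness v < a * T → f u v < T
    central-close {u} {v} cu cv = ≰⇒> λ T≤ → <-irrefl refl (begin-strict
      2 * (a * T)                                 ≡⟨ cong (2 *_) (∑-const as T) ⟨
      2 * ∑ as (λ _ → T)
        ≤⟨ *-monoʳ-≤ 2 (∑-mono as (λ w → ≤-trans T≤ (≤-trans (triangle u w v)
             (+-mono-≤ (m≤m+n (f u w) (f w u)) (m≤n+m (f w v) (f v w)))))) ⟩
      2 * ∑ as (λ w → f u w + f w u + (f v w + f w v)) ≡⟨ cong (2 *_) (∑-+ as _ _) ⟩
      2 * (remoteness u + remoteness v)           ≡⟨ *-distribˡ-+ 2 (remoteness u) (remoteness v) ⟩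
      2 * remoteness u + 2 * remoteness v         <⟨ +-mono-< cu cv ⟩
      a * T + a * T                               ≡⟨ cong (a * T +_) (+-identityʳ (a * T)) ⟨
      2 * (a * T)                                 ∎)
      where open ≤-Reasoning

    -- Markov's inequality: more than `s` of the 2 s vertices have a remoteness of at least a T / 2.
    few-central : ∀ (b : List (Fin n)) s → length b ≡ 2 * s → 0 < a * T →
                   length (filter central? b) < s → s * (a * T) < 2 * ∑ b remoteness
    few-central b s len 0<aT few = +-cancelˡ-< (s * (a * T)) _ _ (begin-strict
      s * (a * T) + s * (a * T)                   ≡⟨ double s (a * T) ⟩
      2 * s * (a * T)                             ≡⟨ trans (∑-const b (a * T)) (cong (_* (a * T)) len) ⟨
      ∑ b (λ _ → a * T)                           ≤⟨ ∑-mono b pointwise ⟩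
      ∑ b (λ u → 𝟙 (does (central? u)) * 1 * (a * T) + 2 * remoteness u)
        ≡⟨ trans (∑-+ b _ _) (cong₂ _+_ (∑-*ʳ b (a * T) _) (∑-*ˡ b 2 remoteness)) ⟩
      ∑ b (λ u → 𝟙 (does (central? u)) * 1) * (a * T) + 2 * ∑ b remoteness
        ≡⟨ cong (λ z → z * (a * T) + 2 * ∑ b remoteness) (trans (sym (∑-filter central? b (λ _ → 1))) (sym (length≡∑ (filter central? b)))) ⟩
      length (filter central? b) * (a * T) + 2 * ∑ b remoteness
        <⟨ +-monoˡ-< (2 * ∑ b remoteness) (*-monoˡ-< (a * T) {{>-nonZero 0<aT}} few) ⟩
      s * (a * T) + 2 * ∑ b remoteness            ∎)
      where
      open ≤-Reasoning
      double : ∀ s k → s * k + s * k ≡ 2 * s * k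
      double = solve-∀
      dichotomy : ∀ {k m} (d : Dec (k < m)) → m ≤ 𝟙 (does d) * 1 * m + k
      dichotomy {m = m} (yes _) = ≤-trans (≤-reflexive (sym (+-identityʳ m))) (m≤m+n _ _)
      dichotomy (no ¬lt)        = ≮⇒≥ ¬lt
      pointwise : ∀ u → a * T ≤ 𝟙 (does (central? u)) * 1 * (a * T) + 2 * remoteness u
      pointwise u = dichotomy (central? u)

  ∸-∸ : ∀ {T k l} → k ≤ l → l ≤ T → (T ∸ k) ∸ (T ∸ l) ≡ l ∸ k
  ∸-∸ {T} {k} {l} k≤l l≤ = trans (∸-+-assoc T k (T ∸ l)) (trans (cong (T ∸_) (+-comm k (T ∸ l)))
    (trans (sym (∸-+-assoc T (T ∸ l) k)) (cong (_∸ k) (m∸[m∸n]≡n l≤))))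

  ∣T∸m-T∸n∣ : ∀ {T k l} → k ≤ T → l ≤ T → ∣ (T ∸ k) - (T ∸ l) ∣ ≡ ∣ k - l ∣
  ∣T∸m-T∸n∣ {T} {k} {l} k≤ l≤ with ≤-total k l
  ... | inj₁ k≤l = trans (m≤n⇒∣n-m∣≡n∸m (∸-monoʳ-≤ T k≤l)) (trans (∸-∸ k≤l l≤) (sym (m≤n⇒∣m-n∣≡n∸m k≤l)))
  ... | inj₂ l≤k = trans (m≤n⇒∣m-n∣≡n∸m (∸-monoʳ-≤ T l≤k)) (trans (∸-∸ l≤k k≤) (sym (m≤n⇒∣n-m∣≡n∸m l≤k)))

  -- The distance to a fixed target drops along an edge by at most its cost. Reflection at `T` turns
  -- this into a bounded ascent, so `concentration` also covers the first argument of the distance.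
  ∸-lipschitz : ∀ T {k l c} → k ≤ c + l → T ∸ l ≤ T ∸ k + c
  ∸-lipschitz T {k} {l} {c} k≤ = m≤n+o⇒m∸n≤o T l (begin
    T                      ≤⟨ m≤n+m∸n T k ⟩
    k + (T ∸ k)            ≤⟨ +-monoˡ-≤ (T ∸ k) k≤ ⟩
    c + l + (T ∸ k)        ≡⟨ rotate c l (T ∸ k) ⟩
    l + (T ∸ k + c)        ∎)
    where
    open ≤-Reasoning
    rotate : ∀ a b c → a + b + c ≡ b + (c + a)
    rotate = solve-∀

  -- Consequences of the minimum degree for a sparse set

  module Density {n : ℕ} (D : MultiDigraph n) (p d : ℕ) (minDeg : ∀ v → p * n ≤ d * simpleDeg D v) where

    adjacency : Fin n → Fin n → ℕ
    adjacency x y = sg (mult D x y + mult D y x)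

    adjacency≤ : ∀ x y → adjacency x y ≤ sg (mult D x y) + sg (mult D y x)
    adjacency≤ x y = subadditive (mult D x y) (mult D y x)
      where
      subadditive : ∀ k l → sg (k + l) ≤ sg k + sg l
      subadditive zero    l = ≤-refl
      subadditive (suc k) l = s≤s z≤n

    adjacency≤1 : ∀ x y → adjacency x y ≤ 1
    adjacency≤1 x y = sg≤1 (mult D x y + mult D y x)

    adjacency-sym : ∀ x y → adjacency x y ≡ adjacency y x
    adjacency-sym x y = cong sg (+-comm (mult D x y) (mult D y x))

    simpleDeg≤ : ∀ v → simpleDeg D v ≤ ∑ V (adjacency v)
    simpleDeg≤ v = begin
      simpleDeg D v                                  ≡⟨ length≡∑ (filter (adj? D v) V) ⟩
      ∑ (filter (adj? D v) V) (λ _ → 1)              ≡⟨ ∑-filter (adj? D v) V (λ _ → 1) ⟩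
      ∑ V (λ u → 𝟙 (does (adj? D v u)) * 1)          ≤⟨ ∑-mono V (λ u → adjacent (adj? D v u)) ⟩
      ∑ V (adjacency v)                              ∎
      where
      open ≤-Reasoning
      adjacent : ∀ {u} (a : Dec (Adj D v u)) → 𝟙 (does a) * 1 ≤ adjacency v u
      adjacent (yes (_ , pos)) = ≤-reflexive (sym (sg-positive pos))
      adjacent (no _)          = z≤n

    degree : ∀ v → p * n ≤ d * ∑ V (adjacency v)
    degree v = ≤-trans (minDeg v) (*-monoʳ-≤ d (simpleDeg≤ v))

    length-V : length (V {n}) ≡ n
    length-V = List.length-tabulate id

    p≤d : 0 < n → p ≤ d
    p≤d 0<n = *-cancelʳ-≤ p d n {{>-nonZero 0<n}} (begin
      p * n                          ≤⟨ degree (fromℕ< 0<n) ⟩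
      d * ∑ V (adjacency _)          ≤⟨ *-monoʳ-≤ d (∑-≤const V (adjacency≤1 _)) ⟩
      d * (length (V {n}) * 1)       ≡⟨ cong (d *_) (trans (*-identityʳ _) length-V) ⟩
      d * n                          ∎)
      where open ≤-Reasoning

    open Cluster adjacency p (2 * d)

    module _ (A : Fin n → Bool) (sparse : Sparse A) where

      private
        χ : Fin n → ℕ
        χ x = 𝟙 (A x)
        a = size A

      size≤ : a ≤ n
      size≤ = ≤-trans (∑-≤const V (λ x → 𝟙≤1 (A x))) (≤-reflexive (trans (*-identityʳ _) length-V))

      -- A pair within `A` is counted from both ends, a boundary pair from one end only.
      weighted-degrees : ∀ (h : Fin n → Fin n → ℕ) → (∀ x y → h x y ≡ h y x) →
        2 * ∑₂ (λ x y → χ x * h x y) ≡ 2 * ∑₂ (λ x y → χ x * χ y * h x y) + boundary h A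
      weighted-degrees h h-sym = begin
        2 * ∑₂ (λ x y → χ x * h x y)
          ≡⟨ cong (∑₂ (λ x y → χ x * h x y) +_) (+-identityʳ _) ⟩
        ∑₂ (λ x y → χ x * h x y) + ∑₂ (λ x y → χ x * h x y)
          ≡⟨ cong₂ _+_ refl (trans (∑₂-swap _) (∑₂-cong (λ x y → cong (χ y *_) (h-sym y x)))) ⟩
        ∑₂ (λ x y → χ x * h x y) + ∑₂ (λ x y → χ y * h x y)
          ≡⟨ trans (∑₂-cong (λ x y → pointwise (A x) (A y) (h x y))) (∑₂-+ _ _) ⟨
        ∑₂ (λ x y → 2 * (χ x * χ y * h x y) + h x y * ∣ χ x - χ y ∣)
          ≡⟨ trans (∑₂-+ _ _) (cong₂ _+_ (∑₂-*ˡ 2 _) refl) ⟩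
        2 * ∑₂ (λ x y → χ x * χ y * h x y) + boundary h A ∎
        where
        open ≡-Reasoning
        case-11 : ∀ h → 2 * (1 * 1 * h) + h * 0 ≡ 1 * h + 1 * h
        case-11 = solve-∀
        case-10 : ∀ h → 2 * (1 * 0 * h) + h * 1 ≡ 1 * h + 0 * h
        case-10 = solve-∀
        case-01 : ∀ h → 2 * (0 * 1 * h) + h * 1 ≡ 0 * h + 1 * h
        case-01 = solve-∀
        case-00 : ∀ h → 2 * (0 * 0 * h) + h * 0 ≡ 0 * h + 0 * h
        case-00 = solve-∀
        pointwise : ∀ a b h → 2 * (𝟙 a * 𝟙 b * h) + h * ∣ 𝟙 a - 𝟙 b ∣ ≡ 𝟙 a * h + 𝟙 b * h
        pointwise true  true  = case-11
        pointwise true  false = case-10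
        pointwise false true  = case-01
        pointwise false false = case-00

      -- The degrees in `A` sum to at least α n a, and sparsity lets at most half of this leave `A`.
      dense : p * n * a ≤ 2 * d * ∑₂ (λ x y → χ x * χ y * adjacency x y)
      dense = *-cancelˡ-≤ 2 (+-cancelʳ-≤ (p * (2 * (a * n))) _ _ (begin
        2 * (p * n * a) + p * (2 * (a * n))
          ≡⟨ shuffle p n a ⟩
        2 * (2 * (a * (p * n)))
          ≡⟨ cong (λ z → 2 * (2 * z)) (∑-*ʳ V (p * n) χ) ⟨
        2 * (2 * ∑ V (λ x → χ x * (p * n)))
          ≤⟨ *-monoʳ-≤ 2 (*-monoʳ-≤ 2 (∑-mono V (λ x → *-monoʳ-≤ (χ x) (degree x)))) ⟩
        2 * (2 * ∑ V (λ x → χ x * (d * ∑ V (adjacency x))))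
          ≡⟨ cong (λ z → 2 * (2 * z)) (trans
               (∑-cong V (λ x → trans (exchange (χ x) d _) (cong (d *_) (sym (∑-*ˡ V (χ x) (adjacency x))))))
               (trans (∑-*ˡ V d _) (cong (d *_) (sym (∑₂-def _))))) ⟩
        2 * (2 * (d * ∑₂ (λ x y → χ x * adjacency x y)))
          ≡⟨ regroup d _ ⟩
        2 * d * (2 * ∑₂ (λ x y → χ x * adjacency x y))
          ≡⟨ cong (2 * d *_) (weighted-degrees adjacency adjacency-sym) ⟩
        2 * d * (2 * I + boundary adjacency A)
          ≡⟨ distrib (2 * d) I (boundary adjacency A) ⟩
        2 * (2 * d * I) + 2 * d * boundary adjacency A
          ≤⟨ +-monoʳ-≤ (2 * (2 * d * I)) (≤-trans sparse (*-monoʳ-≤ p boundary≤)) ⟩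
        2 * (2 * d * I) + p * (2 * (a * n)) ∎))
        where
        open ≤-Reasoning
        I = ∑₂ (λ x y → χ x * χ y * adjacency x y)
        shuffle : ∀ p n a → 2 * (p * n * a) + p * (2 * (a * n)) ≡ 2 * (2 * (a * (p * n)))
        shuffle = solve-∀
        exchange : ∀ a b c → a * (b * c) ≡ b * (a * c)
        exchange = solve-∀
        regroup : ∀ d k → 2 * (2 * (d * k)) ≡ 2 * d * (2 * k)
        regroup = solve-∀
        distrib : ∀ a b c → a * (2 * b + c) ≡ 2 * (a * b) + a * c
        distrib = solve-∀
        boundary≤ : boundary (λ _ _ → 1) A ≤ 2 * (a * n)
        boundary≤ = begin
          boundary (λ _ _ → 1) A                       ≤⟨ m≤n+m _ _ ⟩
          2 * ∑₂ (λ x y → χ x * χ y * 1) + boundary (λ _ _ → 1) A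
            ≡⟨ weighted-degrees (λ _ _ → 1) (λ _ _ → refl) ⟨
          2 * ∑₂ (λ x y → χ x * 1)                     ≡⟨ cong (2 *_) (∑₂-⊗ χ (λ _ → 1)) ⟩
          2 * (a * ∑ (V {n}) (λ _ → 1))                ≡⟨ cong (λ z → 2 * (a * z)) (trans (sym (length≡∑ V)) length-V) ⟩
          2 * (a * n)                                  ∎

      -- `dense` asks for α n a / 2 ordered pairs within `A`, and only a² exist.
      large : 0 < a → p * n ≤ 2 * d * a
      large 0<a = *-cancelʳ-≤ (p * n) (2 * d * a) a {{>-nonZero 0<a}} (begin
        p * n * a                                      ≤⟨ dense ⟩
        2 * d * ∑₂ (λ x y → χ x * χ y * adjacency x y)
          ≤⟨ *-monoʳ-≤ (2 * d) (∑₂-mono (λ x y → ≤-trans (*-monoʳ-≤ (χ x * χ y) (adjacency≤1 x y)) (≤-reflexive (*-identityʳ _)))) ⟩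
        2 * d * ∑₂ (λ x y → χ x * χ y)                 ≡⟨ cong (2 * d *_) (∑₂-⊗ χ χ) ⟩
        2 * d * (a * a)                                ≡⟨ *-assoc (2 * d) a a ⟨
        2 * d * a * a                                  ∎)
        where open ≤-Reasoning

  -- Assembly: from the cluster to the immersion

  module Assembly {n : ℕ} (D : MultiDigraph n) (euler : Eulerian D)
      (p d s : ℕ) (0<p : 0 < p) (0<n : 0 < n) (0<s : 0 < s)
      (minDeg : ∀ v → p * n ≤ d * simpleDeg D v)
      (s-small : 10 ^ 9 * (d * d * (d * d)) * s ≤ p * p * (p * p) * n) where

    open Density D p d minDeg
    open Cluster adjacency p (2 * d)

    module _ (A : Fin n → Bool) (0<a : 0 < size A) (sparse : Sparse A) (connected : Connected A) where

      private
        a σ q : ℕ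
        a = size A
        -- Twice the number of branch vertices, since up to half of a block may fail to be central.
        σ = 2 * s
        instance
          σ≢0 : NonZero σ
          σ≢0 = m*n≢0 2 s {{_}} {{>-nonZero 0<s}}
        q = a / σ

      open Arithmetic p d n a 0<p 0<n 0<a (p≤d 0<n) (size≤ A sparse) (large A sparse 0<a)

      members : List (Fin n)
      members = filter (λ x → T? (A x)) V

      ∑-members : ∀ (f : Fin n → ℕ) → ∑ members f ≡ ∑ V (λ x → 𝟙 (A x) * f x)
      ∑-members f = ∑-filter (λ x → T? (A x)) V f

      length-members : length members ≡ a
      length-members = trans (length≡∑ members) (trans (∑-members (λ _ → 1)) (∑-cong V (λ x → *-identityʳ _)))

      ∑∑-members : ∀ (h : Fin n → Fin n → ℕ) →
                   ∑ members (λ x → ∑ members (h x)) ≡ ∑₂ (λ x y → 𝟙 (A x) * 𝟙 (A y) * h x y)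
      ∑∑-members h = begin
        ∑ members (λ x → ∑ members (h x))
          ≡⟨ trans (∑-members _) (∑-cong V (λ x → cong (𝟙 (A x) *_) (∑-members (h x)))) ⟩
        ∑ V (λ x → 𝟙 (A x) * ∑ V (λ y → 𝟙 (A y) * h x y))
          ≡⟨ ∑-cong V (λ x → ∑-*ˡ V (𝟙 (A x)) _) ⟨
        ∑ V (λ x → ∑ V (λ y → 𝟙 (A x) * (𝟙 (A y) * h x y)))
          ≡⟨ ∑₂-def _ ⟨
        ∑₂ (λ x y → 𝟙 (A x) * (𝟙 (A y) * h x y))
          ≡⟨ ∑₂-cong (λ x y → *-assoc (𝟙 (A x)) (𝟙 (A y)) (h x y)) ⟨
        ∑₂ (λ x y → 𝟙 (A x) * 𝟙 (A y) * h x y) ∎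
        where open ≡-Reasoning

      σ≤a : σ ≤ a
      σ≤a = 2s≤a s s-small

      0<q : 0 < q
      0<q = m≥n⇒m/n>0 σ≤a

      qσ≤a : q * σ ≤ a
      qσ≤a = m/n*n≤m a σ

      -- There is at least one block, so rounding `a / σ` down loses at most a factor 2.
      a≤2qσ : a ≤ 2 * (q * σ)
      a≤2qσ = begin
        a                  ≤⟨ <⇒≤ (m<[1+m/n]*n a σ) ⟩
        σ + q * σ          ≤⟨ +-monoˡ-≤ (q * σ) (≤-trans (≤-reflexive (sym (*-identityˡ σ))) (*-monoˡ-≤ σ 0<q)) ⟩
        q * σ + q * σ      ≡⟨ cong (q * σ +_) (+-identityʳ (q * σ)) ⟨
        2 * (q * σ)        ∎
        where open ≤-Reasoning

      blocks : List (List (Fin n))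
      blocks = chunks σ q members

      blocks-length : All (λ b → length b ≡ σ) blocks
      blocks-length = chunks-length σ q members (≤-trans qσ≤a (≤-reflexive (sym length-members)))

      demands : List (Fin n × Fin n)
      demands = squares blocks

      open Linking D euler A T demands
      open Concentration D euler A T demands adjacency adjacency≤ p (2 * d)

      saturation : Saturated
      saturation = saturate _ empty ≤-refl

      module _ (final : Saturated) where

        open Saturated final

        f : Fin n → Fin n → ℕ
        f = R.dist distance

        M : Fin n → Fin n → ℕ
        M = residual linkage

        N S G : ℕ
        N = links linkage
        S = ∑ members (λ u → ∑ members (f u))
        G = ∑ members (λ u → ∑ members (λ v → sg (M u v)))

        -- The blocks keep the number of demands at `a * σ` instead of `a * a`, as the error
        -- estimates `few-links` and `few-losses` require.
        N≤ : N ≤ a * (2 * s)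
        N≤ = begin
          N                        ≤⟨ ≤-trans (m≤m+n N _) (budget linkage) ⟩
          length demands           ≡⟨ length-squares σ blocks blocks-length ⟩
          length blocks * (σ * σ)  ≡⟨ cong (_* (σ * σ)) (length-chunks σ q members) ⟩
          q * (σ * σ)              ≡⟨ *-assoc q σ σ ⟨
          q * σ * σ                ≤⟨ *-monoˡ-≤ σ qσ≤a ⟩
          a * σ                    ∎
          where open ≤-Reasoning

        f≤T : ∀ u v → f u v ≤ T
        f≤T = R.dist≤T distance

        f-edge : ∀ x y → 0 < M x y → f x y ≤ lastCopy M x y
        f-edge = R.dist-edge distance

        K : ℕ
        K = 2 * d * (6 * (a * a))

        concentrated : ∀ (φ : Fin n → ℕ) → (∀ x → φ x ≤ T) → (∀ x y → 0 < M x y → φ y ≤ φ x + lastCopy M x y) →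
                       p * ∑ members (λ x → ∑ members (λ y → ∣ φ x - φ y ∣)) ≤ K
        concentrated φ φ≤T lip = ≤-trans (≤-reflexive (cong (p *_) (∑∑-members _)))
          (concentration linkage connected (few-links s s-small N N≤) φ φ≤T lip)

        rows : ∀ u → p * ∑ members (λ v → ∑ members (λ v′ → ∣ f u v - f u v′ ∣)) ≤ K
        rows u = concentrated (f u) (f≤T u) (λ x y pos → ≤-trans (triangle u x y) (+-monoʳ-≤ (f u x) (f-edge x y pos)))

        cols : ∀ v → p * ∑ members (λ u → ∑ members (λ u′ → ∣ f u v - f u′ v ∣)) ≤ K
        cols v = ≤-trans (≤-reflexive (cong (p *_) (sym (∑-cong members (λ x → ∑-cong members (λ y → ∣T∸m-T∸n∣ (f≤T x v) (f≤T y v)))))))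
          (concentrated (λ x → T ∸ f x v) (λ x → m∸n≤m T (f x v))
            (λ x y pos → ∸-lipschitz T {k = f x v} {l = f y v} (≤-trans (triangle x y v) (+-monoˡ-≤ (f y v) (f-edge x y pos)))))

        adjacent-close : ∀ u v → sg (M u v) * f u v ≤ sg (M u v)
        adjacent-close u v with M u v in eq
        ... | zero  = z≤n
        ... | suc m = ≤-trans (≤-reflexive (*-identityˡ _)) (≤-trans (f-edge u v (subst (0 <_) (sym eq) z<s))
                        (*-mono-≤ (*-mono-≤ (𝟙≤1 (A u)) (𝟙≤1 (A v))) (isOne≤1 (M u v))))
          where
          isOne≤1 : ∀ m → isOne m ≤ 1
          isOne≤1 0             = z≤n
          isOne≤1 1             = ≤-refl
          isOne≤1 (suc (suc _)) = z≤n

        many : p * n * a ≤ 8 * d * G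
        many = many-survive (inner adjacency) G (N * T) (dense A sparse)
          (≤-trans (surviving linkage) (≤-reflexive (cong (λ z → 2 * (z + N * T)) (sym (∑∑-members _)))))
          (few-losses s s-small N N≤)

        short : p * p * n * S ≤ 194 * (d * d * (a * a * a))
        short = average-distance G S many
          (subst (λ ℓ → p * (G * S) ≤ p * (ℓ * (ℓ * G)) + 2 * (ℓ * (ℓ * K))) length-members
            (averaging members f (λ u v → sg (M u v)) p K (λ u v → sg≤1 (M u v)) adjacent-close rows cols))

        open Centrality members f T triangle

        remoteness-total : ∑ members (remoteness) ≡ 2 * S
        remoteness-total = begin
          ∑ members (λ u → ∑ members (λ w → f u w + f w u))
            ≡⟨ trans (∑-cong members (λ u → ∑-+ members _ _)) (∑-+ members _ _) ⟩
          S + ∑ members (λ u → ∑ members (λ w → f w u))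
            ≡⟨ cong (S +_) (∑-swap members members _) ⟩
          S + S
            ≡⟨ cong (S +_) (+-identityʳ S) ⟨
          2 * S ∎
          where open ≡-Reasoning

        -- A block of at most average remoteness has `s` central vertices; these are pairwise close,
        -- so saturation has linked all of them.
        immerses-in : ∀ b → b ∈ blocks → length blocks * ∑ b remoteness ≤ ∑ blocks (λ b → ∑ b remoteness) → ImmersesK D s
        immerses-in b b∈ average = Links.immersion D euler A T demands linkage central
          (Unique.filter⁺ central? (All.lookup (chunks-unique σ q (Unique.filter⁺ (λ x → T? (A x)) (Unique.allFin⁺ n))) b∈))
          enough paths
          where
          central : List (Fin n)
          central = filter central? b
          qR≤2S : q * ∑ b remoteness ≤ 2 * S
          qR≤2S = begin
            q * ∑ b remoteness                ≡⟨ cong (_* ∑ b remoteness) (length-chunks σ q members) ⟨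
            length blocks * ∑ b remoteness    ≤⟨ average ⟩
            ∑ blocks (λ b → ∑ b remoteness)   ≤⟨ ∑-chunks≤ σ q members remoteness ⟩
            ∑ members remoteness              ≡⟨ remoteness-total ⟩
            2 * S                             ∎
            where open ≤-Reasoning
          0<aT : 0 < length members * T
          0<aT = *-mono-≤ (subst (0 <_) (sym length-members) 0<a) 0<T
          enough : s ≤ length central
          enough = ≮⇒≥ λ few → block-contradiction s q (∑ b remoteness) S short a≤2qσ qR≤2S
            (subst (λ ℓ → s * (ℓ * T) < 2 * ∑ b remoteness) length-members
              (few-central b s (All.lookup blocks-length b∈) 0<aT few))
          paths : ∀ {u v} → u ∈ central → v ∈ central → IsPath D u v (path linkage u v)
          paths {u} {v} u∈ v∈ = saturated u v (∈-squares b∈ (proj₁ u-central) (proj₁ v-central))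
                                              (central-close (proj₂ u-central) (proj₂ v-central))
            where
            u-central = ∈-filter⁻ central? u∈
            v-central = ∈-filter⁻ central? v∈

        immerses : ImmersesK D s
        immerses = immerses-in (proj₁ block) (proj₁ (proj₂ block)) (proj₂ (proj₂ block))
          where
          block : ∃ λ b → b ∈ blocks × length blocks * ∑ b remoteness ≤ ∑ blocks (λ b → ∑ b remoteness)
          block = ∑-pigeonhole blocks (λ b → ∑ b remoteness) (subst (0 <_) (sym (length-chunks σ q members)) 0<q)

    immerses-small : ImmersesK D s
    immerses-small = from-cluster (cluster 0<n)
      where
      from-cluster : (∃ λ A → 0 < size A × Sparse A × Connected A) → ImmersesK D s
      from-cluster (A , 0<a , sparse , connected) = immerses A 0<a sparse connected (saturation A 0<a sparse connected)

  -- The cases s = 0 and n = 0 are split off because blocks need a positive size and the cluster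
  -- search needs a vertex; n = 0 is incompatible with s > 0.
  immersion : ∀ {n} (D : MultiDigraph n) → Eulerian D → ∀ p d s → 0 < p → 0 < d →
    (∀ v → p * n ≤ d * simpleDeg D v) → 10 ^ 9 * (d * d * (d * d)) * s ≤ p * p * (p * p) * n → ImmersesK D s
  immersion         D euler p d zero    0<p 0<d minDeg s-small =
    (λ ()) , (λ { {()} }) , (λ { ((() , _) , _) }) , (λ { ((() , _) , _) }) , λ _ _ → z≤n
  immersion {zero}  D euler p d (suc s) 0<p 0<d minDeg s-small =
    ⊥-elim (<-irrefl refl (≤-trans positive (≤-trans s-small (≤-reflexive (*-zeroʳ (p * p * (p * p)))))))
    where
    positive : 0 < 10 ^ 9 * (d * d * (d * d)) * suc s
    positive = *-mono-≤ (*-mono-≤ {1} {10 ^ 9} (s≤s z≤n) (*-mono-≤ (*-mono-≤ 0<d 0<d) (*-mono-≤ 0<d 0<d))) (s≤s z≤n)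
  immersion {suc n} D euler p d (suc s) 0<p 0<d minDeg s-small =
    Assembly.immerses-small D euler p d (suc s) 0<p z<s z<s minDeg s-small

-- From rational to natural arithmetic

open import Data.Nat using (ℕ)
open import Data.Integer using (∣_∣)
open import Data.Rational using (ℚ; _<_; _≤_; _*_; _/_; 0ℚ; floor)
open import Data.Nat using () renaming (_^_ to _ℕ^_)
import Data.Integer as ℤ

open import Data.Nat using (zero; suc; z<s)
open import Data.Nat.Coprimality using (Coprime)
import Data.Integer.Properties as ℤ
import Data.Nat.Base as ℕ
import Data.Nat.DivMod as ℕ
import Data.Nat.Properties as ℕ
open import Data.Rational using (mkℚ; toℚᵘ; *<*)
import Data.Rational.Properties as ℚ
open import Data.Rational.Unnormalised using (mkℚᵘ; *≡*; *≤*)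
import Data.Rational.Unnormalised as ℚᵘ
import Data.Rational.Unnormalised.Properties as ℚᵘ

open Immersions using (immersion)

-- The value of `q` is a / (b + 1), hence nonnegative, so the absolute value of its floor is the
-- quotient of numerator by denominator.
abs-floor≤ : ∀ (q : ℚ) a b → toℚᵘ q ℚᵘ.≃ mkℚᵘ (ℤ.+ a) b → suc b ℕ.* ∣ floor q ∣ ℕ.≤ a
abs-floor≤ (mkℚ (ℤ.+ m) k _) a b (*≡* e) = ℕ.*-cancelʳ-≤ _ _ (suc k) (begin
  -- Integer division carries the sign of the divisor, whence the factor `ℤ.+ 1`.
  suc b ℕ.* ∣ ℤ.+ 1 ℤ.* ℤ.+ (m ℕ./ suc k) ∣ ℕ.* suc k
    ≡⟨ cong (λ z → suc b ℕ.* z ℕ.* suc k) (trans (ℤ.abs-* (ℤ.+ 1) (ℤ.+ (m ℕ./ suc k))) (ℕ.*-identityˡ (m ℕ./ suc k))) ⟩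
  suc b ℕ.* (m ℕ./ suc k) ℕ.* suc k      ≡⟨ ℕ.*-assoc (suc b) (m ℕ./ suc k) (suc k) ⟩
  suc b ℕ.* (m ℕ./ suc k ℕ.* suc k)      ≤⟨ ℕ.*-monoʳ-≤ (suc b) (ℕ.m/n*n≤m m (suc k)) ⟩
  suc b ℕ.* m                            ≡⟨ ℕ.*-comm (suc b) m ⟩
  m ℕ.* suc b                            ≡⟨ ℤ.+-injective (trans (ℤ.pos-* m (suc b)) (trans e (sym (ℤ.pos-* a (suc k))))) ⟩
  a ℕ.* suc k                            ∎)
  where open ℕ.≤-Reasoning
abs-floor≤ (mkℚ ℤ.-[1+ m ] k _) a b (*≡* e) with trans e (sym (ℤ.pos-* a (suc k)))
... | ()

/-≃ : ∀ i k → toℚᵘ (i / suc k) ℚᵘ.≃ mkℚᵘ i k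
/-≃ i k = ℚ.toℚᵘ-fromℚᵘ (mkℚᵘ i k)

scaled-≤ : ∀ p k .(cop : Coprime p (suc k)) n m → mkℚ (ℤ.+ p) k cop * (ℤ.+ n / 1) ≤ ℤ.+ m / 1 → p ℕ.* n ℕ.≤ suc k ℕ.* m
scaled-≤ p k cop n m h with
  ℚᵘ.≤-respˡ-≃ (ℚᵘ.≃-trans (ℚ.toℚᵘ-homo-* (mkℚ (ℤ.+ p) k cop) (ℤ.+ n / 1)) (ℚᵘ.*-congˡ {mkℚᵘ (ℤ.+ p) k} (/-≃ (ℤ.+ n) 0)))
    (ℚᵘ.≤-respʳ-≃ (/-≃ (ℤ.+ m) 0) (ℚ.toℚᵘ-mono-≤ h))
... | *≤* le = subst₂ ℕ._≤_ (ℕ.*-identityʳ _) (trans (cong (m ℕ.*_) (ℕ.*-identityʳ (suc k))) (ℕ.*-comm m (suc k)))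
    (ℤ.drop‿+≤+ (subst₂ ℤ._≤_ (trans (cong (ℤ._* ℤ.+ 1) (sym (ℤ.pos-* p n))) (sym (ℤ.pos-* (p ℕ.* n) 1)))
                              (sym (ℤ.pos-* m (suc k ℕ.* 1))) le))

-- Normalised products are reduced by unknown common factors; in unnormalised form the numerator and
-- the denominator can be read off.
fourthPower-≃ : ∀ p k .(cop : Coprime p (suc k)) c n → let α = mkℚ (ℤ.+ p) k cop in
  toℚᵘ ((ℤ.+ 1 / suc c) * (α * α * α * α) * (ℤ.+ n / 1)) ℚᵘ.≃
  mkℚᵘ (ℤ.+ 1) c ℚᵘ.* (mkℚᵘ (ℤ.+ p) k ℚᵘ.* mkℚᵘ (ℤ.+ p) k ℚᵘ.* mkℚᵘ (ℤ.+ p) k ℚᵘ.* mkℚᵘ (ℤ.+ p) k) ℚᵘ.* mkℚᵘ (ℤ.+ n) 0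
fourthPower-≃ p k cop c n =
  homo (ℤ.+ 1 / suc c * (α * α * α * α)) (ℤ.+ n / 1)
    (homo (ℤ.+ 1 / suc c) (α * α * α * α) (/-≃ (ℤ.+ 1) c)
      (homo (α * α * α) α (homo (α * α) α (homo α α self self) self) self))
    (/-≃ (ℤ.+ n) 0)
  where
  α : ℚ
  α = mkℚ (ℤ.+ p) k cop
  self : toℚᵘ α ℚᵘ.≃ mkℚᵘ (ℤ.+ p) k
  self = ℚᵘ.≃-refl {mkℚᵘ (ℤ.+ p) k}
  homo : ∀ x y {u v} → toℚᵘ x ℚᵘ.≃ u → toℚᵘ y ℚᵘ.≃ v → toℚᵘ (x * y) ℚᵘ.≃ u ℚᵘ.* v
  homo x y e f = ℚᵘ.≃-trans (ℚ.toℚᵘ-homo-* x y) (ℚᵘ.*-cong e f)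

floor-bound : ∀ p k .(cop : Coprime p (suc k)) c n → let α = mkℚ (ℤ.+ p) k cop in
  suc c ℕ.* (suc k ℕ.* suc k ℕ.* (suc k ℕ.* suc k)) ℕ.* ∣ floor ((ℤ.+ 1 / suc c) * (α * α * α * α) * (ℤ.+ n / 1)) ∣
  ℕ.≤ p ℕ.* p ℕ.* (p ℕ.* p) ℕ.* n
floor-bound p k cop c n = subst (λ z → z ℕ.* ∣ floor q ∣ ℕ.≤ p ℕ.* p ℕ.* (p ℕ.* p) ℕ.* n) (denominator (suc c) (suc k))
  (abs-floor≤ q _ _ (ℚᵘ.≃-trans (fourthPower-≃ p k cop c n) (ℚᵘ.≃-reflexive (cong (λ z → mkℚᵘ z _) numerator))))
  where
  α = mkℚ (ℤ.+ p) k cop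
  q = (ℤ.+ 1 / suc c) * (α * α * α * α) * (ℤ.+ n / 1)
  denominator : ∀ c k → c ℕ.* (k ℕ.* k ℕ.* k ℕ.* k) ℕ.* 1 ≡ c ℕ.* (k ℕ.* k ℕ.* (k ℕ.* k))
  denominator = solve-∀
  numerator : ℤ.+ 1 ℤ.* (ℤ.+ p ℤ.* ℤ.+ p ℤ.* ℤ.+ p ℤ.* ℤ.+ p) ℤ.* ℤ.+ n ≡ ℤ.+ (p ℕ.* p ℕ.* (p ℕ.* p) ℕ.* n)
  numerator = trans (cong (ℤ._* ℤ.+ n) (trans (ℤ.*-identityˡ _) power)) (sym (ℤ.pos-* (p ℕ.* p ℕ.* (p ℕ.* p)) n))
    where
    power : ℤ.+ p ℤ.* ℤ.+ p ℤ.* ℤ.+ p ℤ.* ℤ.+ p ≡ ℤ.+ (p ℕ.* p ℕ.* (p ℕ.* p))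
    power = trans (ℤ.*-assoc (ℤ.+ p ℤ.* ℤ.+ p) (ℤ.+ p) (ℤ.+ p))
      (trans (cong₂ ℤ._*_ (sym (ℤ.pos-* p p)) (sym (ℤ.pos-* p p))) (sym (ℤ.pos-* (p ℕ.* p) (p ℕ.* p))))

theorem5p1 : (α : ℚ) → 0ℚ < α → (n : ℕ) → (D : MultiDigraph n) → Eulerian D →
    (∀ v → α * (ℤ.+ n / 1) ≤ (ℤ.+ simpleDeg D v / 1)) →
    ImmersesK D ∣ floor ((ℤ.+ 1 / (10 ℕ^ 9)) * (α * α * α * α) * (ℤ.+ n / 1)) ∣
theorem5p1 (mkℚ (ℤ.+ suc p) k cop) 0<α n D euler minDeg =
  immersion D euler (suc p) (suc k) _ z<s z<s (λ v → scaled-≤ (suc p) k cop n (simpleDeg D v) (minDeg v))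
    -- `floor-bound` takes the predecessor of the denominator, hence `ℕ.pred`.
    (floor-bound (suc p) k cop (ℕ.pred (10 ℕ^ 9)) n)
theorem5p1 (mkℚ (ℤ.+ zero) k cop) (*<* (ℤ.+<+ ())) n D euler minDeg
theorem5p1 (mkℚ ℤ.-[1+ _ ] k cop) (*<* ()) n D euler minDeg
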